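{- Every connected minor of the half grid $\mathbb{N}\square\mathbb{Z}$ is $\preceq$-ubiquitous.
   Context: The half grid $\mathbb{N}\square\mathbb{Z}$ has vertex set $\mathbb{N}\times\mathbb{Z}$, two vertices being adjacent iff they differ in exactly one coordinate and the difference there is one. $\preceq$ denotes the minor relation and $\alpha G$ the disjoint union of $\alpha$ copies of $G$. A graph $G$ is $\preceq$-ubiquitous if for every graph $\Gamma$ (possibly infinite) with $nG \preceq \Gamma$ for all $n \in \mathbb{N}$ one also has $\aleph_0 G \preceq \Gamma$. -}

module Defs where

open import Level using (Level; _⊔_; 0ℓ; Setω) renaming (suc to lsuc)
open import Data.Nat using (ℕ)
open import Data.Integer using (ℤ; +_; _-_; ∣_∣)
open import Data.Fin using (Fin)
open import Data.Product using (Σ; _×_; _,_; ∃)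
open import Data.Sum using (_⊎_)
open import Relation.Binary.PropositionalEquality using (_≡_; _≢_)

-- A (possibly infinite) simple undirected graph: a vertex type and a relation E.
-- Two distinct vertices x, y are adjacent iff E x y or E y x (see Adj);
-- "loops" E x x are ignored.  Every simple graph is representable this way.
record Graph (ℓ : Level) : Set (lsuc ℓ) where
  field
    V : Set ℓ
    E : V → V → Set ℓ

open Graph public

Adj : ∀ {ℓ} (H : Graph ℓ) → V H → V H → Set ℓ
Adj H x y = E H x y ⊎ E H y x

data PathIn {ℓ} (H : Graph ℓ) (P : V H → Set ℓ) : V H → V H → Set ℓ where
  here : ∀ {x} → P x → PathIn H P x x
  step : ∀ {x z y} → P x → Adj H x z → PathIn H P z y → PathIn H P x y

Connected : ∀ {ℓ} → Graph ℓ → Set ℓ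
Connected {ℓ} G = V G × (∀ x y → PathIn G (λ _ → Lift⊤) x y)
  where
    open import Data.Unit.Polymorphic using () renaming (⊤ to Lift⊤)

record MinorModel {ℓ ℓ'} (G : Graph ℓ) (H : Graph ℓ') : Set (ℓ ⊔ lsuc ℓ') where
  field
    branch    : V G → V H → Set ℓ'
    nonempty  : ∀ u → Σ (V H) (branch u)
    connected : ∀ u x y → branch u x → branch u y → PathIn H (branch u) x y
    disjoint  : ∀ u v x → branch u x → branch v x → u ≡ v
    edges     : ∀ u v → u ≢ v → Adj G u v →
                Σ (V H) λ x → Σ (V H) λ y → branch u x × branch v y × Adj H x y

_≼_ : ∀ {ℓ ℓ'} → Graph ℓ → Graph ℓ' → Set (ℓ ⊔ lsuc ℓ')
G ≼ H = MinorModel G H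

copies : ∀ {ℓ} (I : Set ℓ) → Graph ℓ → Graph ℓ
copies I G = record
  { V = I × V G
  ; E = λ { (i , u) (j , v) → (i ≡ j) × E G u v } }

_·_ : ∀ {ℓ} → ℕ → Graph ℓ → Graph ℓ
n · G = copies (Lift-Fin n) G
  where
    open import Level using (Lift)
    Lift-Fin : ℕ → Set _
    Lift-Fin n = Lift _ (Fin n)

ℵ₀· : ∀ {ℓ} → Graph ℓ → Graph ℓ
ℵ₀· G = copies (Lift _ ℕ) G
  where open import Level using (Lift)

HalfGrid : Graph 0ℓ
HalfGrid = record
  { V = ℕ × ℤ
  ; E = λ { (a , b) (c , d) →
        ((a ≡ c) × (∣ b - d ∣ ≡ 1)) ⊎ ((b ≡ d) × (∣ + a - + c ∣ ≡ 1)) } }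

Ubiquitous : ∀ {ℓ} → Graph ℓ → Setω
Ubiquitous G = ∀ {ℓ'} (Γ : Graph ℓ') → (∀ n → (n · G) ≼ Γ) → ℵ₀· G ≼ Γ

-- Let Γ contain n disjoint models of G for every n, but not infinitely many disjoint ones.  Deleting a
-- finite set X leaves a component which still contains arbitrarily many of the models.  Passing to
-- such a component again and again, one reaches a place where every further model meets the component
-- C X kept after deleting X, for every finite X: the models are concentrated at one end.  If infinitely
-- many vertices dominate this end, Γ has a complete minor of countable order.  Otherwise all but
-- finitely many models contain a ray of the end, stable matchings extend n disjoint rays to n + 1 of
-- them, and in the limit there are infinitely many disjoint rays R i together with disjoint finite
-- connected zones Z t, each joining R 0, ..., R t.  A breadth-first search in Z t with the pieces of the
-- rays contracted partially orders {0, ..., t}.  By Ramsey's theorem, infinitely many rays form a chain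
-- or an antichain in infinitely many of these orders; either way consecutive ones can be joined within
-- those zones avoiding the others.  So in every case Γ has the quadrant ℕ □ ℕ as a minor.
-- The quadrant contains the half grid as a minor, and the half grid consists of two quadrants; hence the
-- quadrant contains infinitely many disjoint models of the half grid, and of every minor of it.
module Submission where

open import Defs
open import Axiom.ExcludedMiddle using (ExcludedMiddle)
open import Level using (lift; lower; _⊔_) renaming (suc to lsuc)
open import Data.Empty using (⊥; ⊥-elim)
import Data.Empty.Polymorphic as Poly
open import Data.Fin using (Fin; zero; suc; toℕ; fromℕ<; inject≤)
open import Data.Fin.Properties using (inject≤-injective; pigeonhole; toℕ-injective)
import Data.Fin.Properties as Finₚ
open import Data.Integer using (ℤ; +_; -[1+_])
import Data.Integer as ℤ
import Data.Integer.Properties as ℤₚ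
open import Data.List
  using (List; []; _∷_; _++_; length; map; filter; concat; lookup; applyUpTo; tabulate)
open import Data.List.Membership.Propositional using (_∈_; _∉_)
open import Data.List.Membership.Propositional.Properties
  using (∈-++⁺ˡ; ∈-++⁺ʳ; ∈-++⁻; ∈-filter⁺; ∈-filter⁻; ∈-concat⁺′; ∈-map⁺; ∈-lookup;
         ∈-applyUpTo⁺; ∈-applyUpTo⁻)
open import Data.List.Properties using (length-tabulate)
open import Data.List.Relation.Binary.Subset.Propositional using (_⊆_)
open import Data.List.Relation.Unary.All using (All; []; _∷_)
import Data.List.Relation.Unary.All as All
import Data.List.Relation.Unary.All.Properties as Allₚ
open import Data.List.Relation.Unary.AllPairs using (AllPairs; []; _∷_)
import Data.List.Relation.Unary.AllPairs.Properties as AllPairsₚ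
open import Data.List.Relation.Unary.Any using (here; there)
open import Data.Nat using (ℕ; zero; suc; _+_; _≤_; _<_; z≤n; s≤s; _≤?_; _≟_; ⌊_/2⌋)
  renaming (_⊔_ to max)
open import Data.Nat.Induction using (<-rec)
open import Data.Nat.Properties hiding (_≟_)
open import Data.Product using (Σ; Σ-syntax; _×_; _,_; proj₁; proj₂)
open import Data.Sum using (_⊎_; inj₁; inj₂; [_,_]′)
open import Data.Unit.Polymorphic using (⊤; tt)
open import Function using (_∘_; id; case_of_)
open import Relation.Binary.Definitions using (tri<; tri≈; tri>)
open import Relation.Binary.PropositionalEquality
  using (_≡_; _≢_; refl; sym; trans; cong; subst; subst₂)
open import Relation.Nullary using (Dec; yes; no; ¬_; ¬?)

-- Classical logic and paths inside vertex sets

module Classical (em : ∀ {ℓ} → ExcludedMiddle ℓ) where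

  dec : ∀ {p} (P : Set p) → Dec P
  dec P = em

  abstract
    ¬¬-elim : ∀ {p} {P : Set p} → ¬ ¬ P → P
    ¬¬-elim {P = P} ¬¬p with dec P
    ... | yes p = p
    ... | no ¬p = ⊥-elim (¬¬p ¬p)

    ¬∀⇒∃¬ : ∀ {a p} {A : Set a} {P : A → Set p} → ¬ (∀ x → P x) → Σ A λ x → ¬ P x
    ¬∀⇒∃¬ ¬∀ = ¬¬-elim λ ¬∃ → ¬∀ λ x → ¬¬-elim λ ¬p → ¬∃ (x , ¬p)

module Paths {ℓ} (Γ : Graph ℓ) where

  VSet : Set (lsuc ℓ)
  VSet = V Γ → Set ℓ

  private variable
    P Q R : V Γ → Set ℓ
    x y z : V Γ

  adj-sym : Adj Γ x y → Adj Γ y x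
  adj-sym = [ inj₂ , inj₁ ]′

  source : PathIn Γ P x y → P x
  source (here p) = p
  source (step p _ _) = p

  target : PathIn Γ P x y → P y
  target (here p) = p
  target (step _ _ ps) = target ps

  infixr 5 _⊕_

  _⊕_ : PathIn Γ P x y → PathIn Γ P y z → PathIn Γ P x z
  here _ ⊕ qs = qs
  step p e ps ⊕ qs = step p e (ps ⊕ qs)

  path-map : (∀ {v} → P v → Q v) → PathIn Γ P x y → PathIn Γ Q x y
  path-map f (here p) = here (f p)
  path-map f (step p e ps) = step (f p) e (path-map f ps)

  edge : P x → Adj Γ x y → P y → PathIn Γ P x y
  edge p e q = step p e (here q)

  reverse : PathIn Γ P x y → PathIn Γ P y x
  reverse (here p) = here p
  reverse (step p e ps) = reverse ps ⊕ edge (source ps) (adj-sym e) p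

  Conn : VSet → Set ℓ
  Conn S = ∀ {x y} → S x → S y → PathIn Γ S x y

  conn-from : ∀ x → (∀ {y} → P y → PathIn Γ P x y) → Conn P
  conn-from x f p q = reverse (f p) ⊕ f q

  -- Induction along the path. It serves for sets `Q` that are closed under adjacency within `P`,
  -- such as components.
  along : (∀ {v w} → Q v → Adj Γ v w → P w → Q w) → Q x → PathIn Γ P x y →
    PathIn Γ (λ v → P v × Q v) x y
  along f q (here p) = here (p , q)
  along f q (step p e ps) = step (p , q) e (along f (f q e (source ps)) ps)

  verts : PathIn Γ P x y → List (V Γ)
  verts {x = x} (here _) = x ∷ []
  verts {x = x} (step _ _ ps) = x ∷ verts ps

  verts-all : (ps : PathIn Γ P x y) → ∀ {z} → z ∈ verts ps → P z
  verts-all (here p) (here refl) = p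
  verts-all (step p _ _) (here refl) = p
  verts-all (step _ _ ps) (there i) = verts-all ps i

  source∈ : (ps : PathIn Γ P x y) → x ∈ verts ps
  source∈ (here _) = here refl
  source∈ (step _ _ _) = here refl

  target∈ : (ps : PathIn Γ P x y) → y ∈ verts ps
  target∈ (here _) = here refl
  target∈ (step _ _ ps) = there (target∈ ps)

  to-vert : (ps : PathIn Γ P x y) → ∀ {z} → z ∈ verts ps → PathIn Γ (_∈ verts ps) x z
  to-vert (here _) (here refl) = here (here refl)
  to-vert (step _ _ _) (here refl) = here (here refl)
  to-vert (step _ e ps) (there i) = step (here refl) e (path-map there (to-vert ps i))

  verts-conn : (ps : PathIn Γ P x y) → Conn (_∈ verts ps)
  verts-conn ps = conn-from _ (to-vert ps)

  conn-∪ : Conn P → Conn Q → P z → Q z → (∀ {v} → R v → P v ⊎ Q v) →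
    (∀ {v} → P v → R v) → (∀ {v} → Q v → R v) → Conn R
  conn-∪ {z = z} cP cQ p q split l r = conn-from z λ s → case split s of λ
    { (inj₁ p′) → path-map l (cP p p′)
    ; (inj₂ q′) → path-map r (cQ q q′) }

  conn-++ : ∀ {xs ys} → Conn (_∈ xs) → Conn (_∈ ys) → z ∈ xs → z ∈ ys → Conn (_∈ xs ++ ys)
  conn-++ {xs = xs} cx cy i j =
    conn-∪ cx cy i j (∈-++⁻ xs) ∈-++⁺ˡ (∈-++⁺ʳ xs)

  Disj : VSet → VSet → Set ℓ
  Disj S T = ∀ {x} → S x → ¬ T x

  DisjointSeq : (ℕ → VSet) → Set ℓ
  DisjointSeq S = ∀ {i j} → i < j → Disj (S i) (S j)

  comp : List (V Γ) → V Γ → VSet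
  comp X v = PathIn Γ (_∉ X) v

  module _ (em : ∀ {ℓ} → ExcludedMiddle ℓ) where
    open Classical em

    abstract
      first-hit : (Q : VSet) → PathIn Γ P x y → ¬ Q x → Q y →
        Σ[ a ∈ V Γ ] Σ[ b ∈ V Γ ] PathIn Γ (λ v → P v × ¬ Q v) x a × Adj Γ a b × P b × Q b
      first-hit Q (here _) ¬q q = ⊥-elim (¬q q)
      first-hit Q (step {z = z} p e ps) ¬q q with dec (Q z)
      ... | yes qz = _ , z , here (p , ¬q) , e , source ps , qz
      ... | no ¬qz with first-hit Q ps ¬qz q
      ...   | a , b , ps′ , e′ , pb , qb = a , b , step (p , ¬q) e ps′ , e′ , pb , qb

    stays-or-exits : (Q : VSet) → PathIn Γ P x y → Q y → PathIn Γ (λ v → P v × Q v) x y ⊎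
      (Σ[ a ∈ V Γ ] Σ[ b ∈ V Γ ]
        PathIn Γ P x a × ¬ Q a × Adj Γ a b × PathIn Γ (λ v → P v × Q v) b y)
    stays-or-exits Q (here p) q = inj₁ (here (p , q))
    stays-or-exits {x = x} Q (step p e ps) q with stays-or-exits Q ps q
    ... | inj₂ (a , b , l , ¬qa , e′ , r) = inj₂ (a , b , step p e l , ¬qa , e′ , r)
    ... | inj₁ r with dec (Q x)
    ...   | yes qx = inj₁ (step (p , qx) e r)
    ...   | no ¬qx = inj₂ (x , _ , here p , ¬qx , e , r)

    abstract
      last-exit : (Q : VSet) → PathIn Γ P x y → ¬ Q x → Q y →
        Σ[ a ∈ V Γ ] Σ[ b ∈ V Γ ]
          PathIn Γ P x a × ¬ Q a × Adj Γ a b × PathIn Γ (λ v → P v × Q v) b y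
      last-exit Q ps ¬q q with stays-or-exits Q ps q
      ... | inj₁ r = ⊥-elim (¬q (proj₂ (source r)))
      ... | inj₂ r = r

-- Havens: an end at which the models concentrate

record EndSet {ℓ} (Γ : Graph ℓ) (X₀ : List (V Γ)) (C : List (V Γ) → V Γ → Set ℓ)
  (X : List (V Γ)) (S : V Γ → Set ℓ) : Set ℓ where
  field
    conn   : Paths.Conn Γ S
    avoid  : ∀ {v} → S v → v ∉ X
    avoid₀ : ∀ {v} → S v → v ∉ X₀
    meets  : ∀ Y → Σ[ v ∈ V Γ ] S v × C Y v

-- An end, given by the component `C X` of the graph minus `X` and `X₀` in which it lives; `X₀` is
-- deleted once and for all. Of the models only their vertex sets are kept in `supply`, and meeting
-- every `C Y` stands for running into the end.
record Haven {ℓ} (Γ : Graph ℓ) (X₀ : List (V Γ)) : Set (lsuc ℓ) where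
  open Paths Γ
  field
    C        : List (V Γ) → VSet
    C-conn   : ∀ X → Conn (C X)
    C-avoid  : ∀ {X v} → C X v → v ∉ X
    C-avoid₀ : ∀ {X v} → C X v → v ∉ X₀
    C-closed : ∀ {X v w} → C X v → Adj Γ v w → w ∉ X → w ∉ X₀ → C X w
    C-mono   : ∀ {X Y v} → X ⊆ Y → C Y v → C X v
    C-inh    : ∀ X → Σ (V Γ) (C X)

    supply   : ∀ n X → Σ[ Ss ∈ List VSet ] n ≤ length Ss × AllPairs Disj Ss ×
      All (EndSet Γ X₀ C X) Ss

module Concentration (em : ∀ {ℓ} → ExcludedMiddle ℓ) {ℓ} (Γ : Graph ℓ)
  {g} (𝒢 : (V Γ → Set ℓ) → Set g)
  (𝒢-conn : ∀ {S} → 𝒢 S → Paths.Conn Γ S)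
  (𝒢-inh : ∀ {S} → 𝒢 S → Σ (V Γ) S)
  (none : ¬ (Σ[ S ∈ (ℕ → V Γ → Set ℓ) ] (∀ i → 𝒢 (S i)) × Paths.DisjointSeq Γ S))
  where

  open Classical em
  open Paths Γ

  Fat : ∀ {p} → (VSet → Set p) → Set _
  Fat P = ∀ n → Σ[ Ss ∈ List VSet ] n ≤ length Ss × AllPairs Disj Ss × All (λ S → 𝒢 S × P S) Ss

  module _ {p q r} {P : VSet → Set p} {Q : VSet → Set q} {R : VSet → Set r} where

    length-filter-∁ : ∀ Ss → length (filter (λ S → dec (Q S)) Ss) +
      length (filter (λ S → ¬? (dec (Q S))) Ss) ≡ length Ss
    length-filter-∁ [] = refl
    length-filter-∁ (S ∷ Ss) with dec (Q S)
    ... | yes _ = cong suc (length-filter-∁ Ss)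
    ... | no _ = trans (+-suc _ _) (cong suc (length-filter-∁ Ss))

    -- Pigeonhole: if no family of size `n₀` lies in `Q`, then among `n₀ + n` disjoint sets with `P`
    -- fewer than `n₀` satisfy `Q`, which leaves at least `n` for `R`.
    fat-split : Fat P → (∀ {S} → 𝒢 S → P S → Q S ⊎ R S) → Fat Q ⊎ Fat R
    fat-split fat split with dec (Fat Q)
    ... | yes fatQ = inj₁ fatQ
    ... | no ¬fatQ = inj₂ fatR
      where
      n₀ = proj₁ (¬∀⇒∃¬ ¬fatQ)
      fatR : Fat R
      fatR n with fat (n₀ + n)
      ... | Ss , len , disj , all = ¬Qs , len′ , AllPairsₚ.filter⁺ _ disj ,
              All.zipWith toR (Allₚ.all-filter _ Ss , Allₚ.filter⁺ _ all)
        where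
        Qs = filter (λ S → dec (Q S)) Ss
        ¬Qs = filter (λ S → ¬? (dec (Q S))) Ss
        toR : ∀ {S} → ¬ Q S × (𝒢 S × P S) → 𝒢 S × R S
        toR (¬q , g , p) = g , [ (λ q → ⊥-elim (¬q q)) , id ]′ (split g p)
        fewQs : length Qs < n₀
        fewQs = ≰⇒> λ n₀≤ → proj₂ (¬∀⇒∃¬ ¬fatQ)
          (Qs , n₀≤ , AllPairsₚ.filter⁺ _ disj ,
            All.zipWith (λ { (q , g , _) → g , q }) (Allₚ.all-filter _ Ss , Allₚ.filter⁺ _ all))
        len′ : n ≤ length ¬Qs
        len′ = ≮⇒≥ λ lt → <⇒≱ (+-mono-< fewQs lt)
          (subst (n₀ + n ≤_) (sym (length-filter-∁ Ss)) len)

  fat-inh : ∀ {p} {P : VSet → Set p} → Fat P → Σ[ S ∈ VSet ] 𝒢 S × P S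
  fat-inh fat with fat 1
  ... | S ∷ _ , _ , _ , (g , p) ∷ _ = S , g , p

  fat-map : ∀ {p q} {P : VSet → Set p} {Q : VSet → Set q} →
    (∀ {S} → 𝒢 S → P S → Q S) → Fat P → Fat Q
  fat-map f fat n with fat n
  ... | Ss , len , disj , all = Ss , len , disj , All.map (λ { (g , p) → g , f g p }) all

  Avoids : List (V Γ) → VSet → Set ℓ
  Avoids X S = ∀ v → S v → v ∉ X

  thin-at : ∀ v → ¬ Fat (λ S → S v)
  thin-at v fat with fat 2
  ... | _ ∷ _ ∷ _ , _ , (disj ∷ _) ∷ _ , (_ , s) ∷ (_ , t) ∷ _ = disj s t
  ... | _ ∷ [] , s≤s () , _

  -- Disjoint sets share no vertex, so the sets through one vertex are never fat, and the vertices
  -- of `X` can be discarded one at a time.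
  fat-avoid : ∀ {p} {P : VSet → Set p} → Fat P → ∀ X → Fat (λ S → P S × Avoids X S)
  fat-avoid fat [] = fat-map (λ _ p → p , λ _ _ ()) fat
  fat-avoid {P = P} fat (x ∷ X)
    with fat-split {Q = λ S → S x} {R = λ S → P S × Avoids (x ∷ X) S} (fat-avoid fat X) split
    where
    split : ∀ {S} → 𝒢 S → P S × Avoids X S → S x ⊎ (P S × Avoids (x ∷ X) S)
    split {S} _ (p , av) with dec (S x)
    ... | yes s = inj₁ s
    ... | no ¬s = inj₂ (p , λ { _ s (here refl) → ¬s s ; v s (there i) → av v s i })
  ... | inj₁ fat-x = ⊥-elim (thin-at x fat-x)
  ... | inj₂ fat′ = fat′

  Inside : VSet → VSet → Set ℓ
  Inside U S = ∀ v → S v → U v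

  -- If finitely many components contained all sets, one of them would be fat; otherwise sets
  -- chosen from ever new components would form an infinite disjoint sequence.
  fat-comp : ∀ {p} {P : VSet → Set p} → Fat P → ∀ X →
    Σ[ v ∈ V Γ ] Fat (λ S → P S × Inside (comp X v) S)
  fat-comp {P = P} fat X with dec (Σ[ L ∈ List (V Γ) ] (∀ {S} → 𝒢 S → P S × Avoids X S →
    Σ[ v ∈ V Γ ] v ∈ L × Inside (comp X v) S))
  ... | yes (L , cover) = pick L (fat-map (λ g p → p , cover g p) (fat-avoid fat X))
    where
    pick : ∀ L → Fat (λ S → (P S × Avoids X S) × Σ[ v ∈ V Γ ] v ∈ L × Inside (comp X v) S) →
      Σ[ v ∈ V Γ ] Fat (λ S → P S × Inside (comp X v) S)
    pick [] fat′ with fat-inh fat′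
    ... | ()
    pick (v ∷ L) fat′ with fat-split fat′ (λ { _ ((p , _) , _ , here refl , ins) → inj₁ (p , ins)
      ; _ (p , w , there i , ins) → inj₂ (p , w , i , ins) })
    ... | inj₁ found = v , found
    ... | inj₂ fat″ = pick L fat″
  ... | no ¬cover = ⊥-elim (none (S ∘ Ls , (λ i → proj₁ (proj₂ (fresh (Ls i)))) , disjoint))
    where
    fresh : ∀ L → Σ[ S ∈ VSet ] 𝒢 S × Avoids X S × (∀ {v} → v ∈ L → ¬ Inside (comp X v) S)
    fresh L = ¬¬-elim λ none-fresh → ¬cover (L , λ {S} g p → ¬¬-elim λ ¬c →
      none-fresh (S , g , proj₂ p , λ {v} i ins → ¬c (v , i , ins)))
    S : List (V Γ) → VSet
    S L = proj₁ (fresh L)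
    base : ∀ L → Σ (V Γ) (S L)
    base L = 𝒢-inh (proj₁ (proj₂ (fresh L)))
    Ls : ℕ → List (V Γ)
    Ls zero = []
    Ls (suc n) = proj₁ (base (Ls n)) ∷ Ls n
    base∈ : ∀ {i j} → i < j → proj₁ (base (Ls i)) ∈ Ls j
    base∈ {i} {suc j} (s≤s i≤j) with m≤n⇒m<n∨m≡n i≤j
    ... | inj₁ i<j = there (base∈ i<j)
    ... | inj₂ refl = here refl
    avoid : ∀ n → Avoids X (S (Ls n))
    avoid n = proj₁ (proj₂ (proj₂ (fresh (Ls n))))
    disjoint : DisjointSeq (S ∘ Ls)
    disjoint {i} {j} i<j x∈i x∈j = proj₂ (proj₂ (proj₂ (fresh (Ls j)))) (base∈ i<j) λ _ v∈j →
      path-map (avoid i _) (𝒢-conn (proj₁ (proj₂ (fresh (Ls i)))) (proj₂ (base (Ls i))) x∈i)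
      ⊕ path-map (avoid j _) (𝒢-conn (proj₁ (proj₂ (fresh (Ls j)))) x∈j v∈j)

  FatAt : List (V Γ) → V Γ → Set _
  FatAt X v = Fat (Inside (comp X v))

  Concentrated : List (V Γ) → V Γ → Set _
  Concentrated X v = ∀ X′ v′ → FatAt X′ v′ → Inside (comp X v) (comp X′ v′) →
    ∀ {S} → 𝒢 S → Inside (comp X v) S → Σ[ w ∈ V Γ ] S w × comp X′ v′ w

  -- Otherwise every fat component contains a member of `𝒢` that misses some smaller fat component.
  -- Iterating this, each member misses the component in which all later ones lie, so they form an
  -- infinite disjoint sequence, against `none`.
  concentration : Fat (λ _ → ⊤ {ℓ}) → Σ[ X ∈ List (V Γ) ] Σ[ v ∈ V Γ ] FatAt X v × Concentrated X v
  concentration fat = ¬¬-elim λ none-conc → none (escaping none-conc)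
    where
    State : Set _
    State = Σ[ X ∈ List (V Γ) ] Σ[ v ∈ V Γ ] FatAt X v
    U : State → VSet
    U (X , v , _) = comp X v
    Escape : State → Set _
    Escape s = Σ[ s′ ∈ State ] Inside (U s) (U s′) × Σ[ S ∈ VSet ] 𝒢 S × Inside (U s) S × Disj S (U s′)
    escaping : ¬ (Σ[ X ∈ List (V Γ) ] Σ[ v ∈ V Γ ] FatAt X v × Concentrated X v) →
      Σ[ S ∈ (ℕ → VSet) ] (∀ i → 𝒢 (S i)) × DisjointSeq S
    escaping none-conc = S , (λ i → proj₁ (proj₂ (proj₂ (proj₂ (esc (st i)))))) , disjoint
      where
      esc : ∀ s → Escape s
      esc s@(X , v , f) = ¬¬-elim λ ¬esc → none-conc (X , v , f , λ X′ v′ f′ ins {S} g insS →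
        ¬¬-elim λ ¬meet → ¬esc ((X′ , v′ , f′) , ins , S , g , insS , λ {_} s∈ u → ¬meet (_ , s∈ , u)))
      st : ℕ → State
      st zero = let v , f = fat-comp fat [] in [] , v , fat-map (λ _ → proj₂) f
      st (suc n) = proj₁ (esc (st n))
      S : ℕ → VSet
      S n = proj₁ (proj₂ (proj₂ (esc (st n))))
      nested : ∀ {i j} → i ≤ j → Inside (U (st i)) (U (st j))
      nested {i} {j} i≤j x u with m≤n⇒m<n∨m≡n i≤j
      nested {i} {suc j} i≤j x u | inj₁ (s≤s i≤j′) = nested i≤j′ x (proj₁ (proj₂ (esc (st j))) x u)
      nested i≤j x u | inj₂ refl = u
      disjoint : DisjointSeq S
      disjoint {i} {j} i<j x∈i x∈j =
        proj₂ (proj₂ (proj₂ (proj₂ (proj₂ (esc (st i)))))) x∈i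
          (nested i<j _ (proj₁ (proj₂ (proj₂ (proj₂ (proj₂ (esc (st j)))))) _ x∈j))

  -- `C X` is any component of the graph minus `X` and `X₀` that receives arbitrarily many members
  -- of `𝒢` from the concentrated component. The choices for different `X` are made independently;
  -- concentration makes them coherent.
  haven : Fat (λ _ → ⊤ {ℓ}) → Σ (List (V Γ)) (Haven Γ)
  haven fat with concentration fat
  ... | X₀ , v₀ , fat₀ , conc = X₀ , record
    { C = C
    ; C-conn = λ X {a} {b} a∈ b∈ → path-map proj₂
        (along (λ { c e c∉ → c ⊕ edge (target c) e c∉ }) a∈ (reverse a∈ ⊕ b∈))
    ; C-avoid = λ {X} c i → target c (∈-++⁺ˡ i)
    ; C-avoid₀ = λ {X} c i → target c (∈-++⁺ʳ X i)
    ; C-closed = λ {X} c e w∉X w∉X₀ → c ⊕ edge (target c) e ([ w∉X , w∉X₀ ]′ ∘ ∈-++⁻ X)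
    ; C-mono = mono
    ; C-inh = λ X → let _ , g , _ , ins = fat-inh (proj₂ (choice X))
                        s , s∈ = 𝒢-inh g in s , ins s s∈
    ; supply = λ n X → let Ss , len , disj , all = fat-avoid (fat-avoid fat₀ X) X₀ n
        in Ss , len , disj , All.map (λ { (g , (ins , av) , av₀) → record
            { conn = 𝒢-conn g ; avoid = av _ ; avoid₀ = av₀ _
            ; meets = λ Y → conc _ _ (C-fat Y) (C⊆U Y) g ins } }) all
    }
    where
    choice : ∀ X → Σ[ v ∈ V Γ ] Fat (λ S → Inside (comp X₀ v₀) S × Inside (comp (X ++ X₀) v) S)
    choice X = fat-comp fat₀ (X ++ X₀)
    C : List (V Γ) → VSet
    C X = comp (X ++ X₀) (proj₁ (choice X))
    C-fat : ∀ X → FatAt (X ++ X₀) (proj₁ (choice X))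
    C-fat X = fat-map (λ _ → proj₂) (proj₂ (choice X))
    C⊆U : ∀ X → Inside (comp X₀ v₀) (C X)
    C⊆U X v c with fat-inh (proj₂ (choice X))
    ... | S , g , insU , insC with 𝒢-inh g
    ...   | s , s∈ = insU s s∈ ⊕ path-map (λ z∉ i → z∉ (∈-++⁺ʳ X i)) (reverse (insC s s∈) ⊕ c)
    -- A member of `𝒢` inside `C Y` meets the fat component `C X`, and `C Y` is connected outside
    -- `X ++ X₀`; hence all of it lies in `C X`.
    mono : ∀ {X Y v} → X ⊆ Y → C Y v → C X v
    mono {X} {Y} X⊆Y c with fat-inh (proj₂ (choice Y))
    ... | S , g , insU , insC with conc _ _ (C-fat X) (C⊆U X) g insU
    ...   | w , w∈S , w∈C = w∈C ⊕ path-map (λ z∉ i → z∉ (grow i)) (reverse (insC w w∈S) ⊕ c)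
      where
      grow : X ++ X₀ ⊆ Y ++ X₀
      grow i = [ ∈-++⁺ˡ ∘ X⊆Y , ∈-++⁺ʳ Y ]′ (∈-++⁻ X i)

-- Pairing of natural numbers and models of the quadrant

unpair : ℕ → ℕ × ℕ
unpair zero = 0 , 0
unpair (suc n) with unpair n
... | zero , b = suc b , 0
... | suc a , b = a , suc b

unpair-surj : ∀ a b → Σ[ n ∈ ℕ ] unpair n ≡ (a , b)
unpair-surj a b = diagonal (a + b) a b refl
  where
  diagonal : ∀ s a b → a + b ≡ s → Σ[ n ∈ ℕ ] unpair n ≡ (a , b)
  diagonal s a (suc b) eq with diagonal s (suc a) b (trans (sym (+-suc a b)) eq)
  ... | n , hit = suc n , next
    where
    next : unpair (suc n) ≡ (a , suc b)
    next rewrite hit = refl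
  diagonal zero zero zero _ = 0 , refl
  diagonal (suc s) (suc a) zero eq
    with diagonal s 0 a (suc-injective (trans (cong suc (sym (+-identityʳ a))) eq))
  ... | n , hit = suc n , next
    where
    next : unpair (suc n) ≡ (suc a , 0)
    next rewrite hit = refl

-- A section of Cantor's enumeration by antidiagonals, hence injective.
pair : ℕ → ℕ → ℕ
pair a b = proj₁ (unpair-surj a b)

unpair-pair : ∀ a b → unpair (pair a b) ≡ (a , b)
unpair-pair a b = proj₂ (unpair-surj a b)

pair-injective : ∀ {a b c d} → pair a b ≡ pair c d → (a , b) ≡ (c , d)
pair-injective {a} {b} {c} {d} eq =
  trans (sym (unpair-pair a b)) (trans (cong unpair eq) (unpair-pair c d))

Quadrant : Graph Level.zero
Quadrant = record
  { V = ℕ × ℕ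
  ; E = λ { (a , b) (c , d) → (a ≡ c × d ≡ suc b) ⊎ (b ≡ d × c ≡ suc a) } }

record QuadrantCells {ℓ} (Γ : Graph ℓ) : Set (lsuc ℓ) where
  open Paths Γ
  field
    cell       : ℕ → ℕ → VSet
    inhabited  : ∀ a b → Σ (V Γ) (cell a b)
    connected  : ∀ a b → Conn (cell a b)
    disjoint   : ∀ {a b c d x} → cell a b x → cell c d x → (a , b) ≡ (c , d)
    vertical   : ∀ a b → Σ[ x ∈ V Γ ] Σ[ y ∈ V Γ ] cell a b x × cell a (suc b) y × Adj Γ x y
    horizontal : ∀ a b → Σ[ x ∈ V Γ ] Σ[ y ∈ V Γ ] cell a b x × cell (suc a) b y × Adj Γ x y

  model : Quadrant ≼ Γ
  model = record
    { branch = λ { (a , b) → cell a b }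
    ; nonempty = λ { (a , b) → inhabited a b }
    ; connected = λ { (a , b) x y → connected a b }
    ; disjoint = λ { (a , b) (c , d) x → disjoint }
    ; edges = λ
      { (a , b) _ _ (inj₁ (inj₁ (refl , refl))) → vertical a b
      ; (a , b) _ _ (inj₁ (inj₂ (refl , refl))) → horizontal a b
      ; _ (a , b) _ (inj₂ (inj₁ (refl , refl))) → swap (vertical a b)
      ; _ (a , b) _ (inj₂ (inj₂ (refl , refl))) → swap (horizontal a b) }
    }
    where
    swap : ∀ {S T : VSet} → Σ[ x ∈ V Γ ] Σ[ y ∈ V Γ ] S x × T y × Adj Γ x y →
      Σ[ x ∈ V Γ ] Σ[ y ∈ V Γ ] T x × S y × Adj Γ x y
    swap (x , y , s , t , e) = y , x , t , s , adj-sym e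

-- Vertices that dominate the end

module Domination (em : ∀ {ℓ} → ExcludedMiddle ℓ) {ℓ} (Γ : Graph ℓ) {X₀ : List (V Γ)}
  (H : Haven Γ X₀) where

  open Classical em
  open Paths Γ
  open Haven H

  Dominates : VSet
  Dominates v = ∀ X → v ∉ X → C X v

  -- A candidate branch set around the hub `v`, off the used vertices `X` and adjacent to all
  -- targets `M`.
  Spoked : List (V Γ) → V Γ → (V Γ → Set ℓ) → Set ℓ
  Spoked X v M = Σ[ L ∈ List (V Γ) ] Conn (_∈ L) × v ∈ L × (∀ {z} → z ∈ L → z ∉ X) ×
    (∀ {m} → M m → Σ[ a ∈ V Γ ] a ∈ L × Adj Γ a m)

  -- Let `Y` be `X` without `m`. Both vertices dominate, so `C Y` contains a path from `v` to `m`;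
  -- stopped just before `m` it avoids all of `X`.
  spoke : ∀ {X v m} → Dominates v → Dominates m → v ∉ X → m ∈ X → Spoked X v (m ≡_)
  spoke {X} {v} {m} dv dm v∉X m∈X
    with first-hit em (_≡ m) (C-conn Y (dv Y (v∉X ∘ Y⊆X)) (dm Y m∉Y)) (λ { refl → v∉X m∈X }) refl
    where
    ≢m? = λ z → ¬? (dec (z ≡ m))
    Y = filter ≢m? X
    Y⊆X : Y ⊆ X
    Y⊆X i = proj₁ (∈-filter⁻ ≢m? i)
    m∉Y : m ∉ Y
    m∉Y i = proj₂ (∈-filter⁻ ≢m? {xs = X} i) refl
  ... | a , _ , ps , e , _ , refl =
    verts ps , verts-conn ps , source∈ ps ,
    (λ i z∈X → let c , z≢m = verts-all ps i
               in C-avoid c (∈-filter⁺ (λ z → ¬? (dec (z ≡ m))) z∈X z≢m)) ,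
    λ { refl → a , target∈ ps , e }

  spokes : ∀ {X v} → Dominates v → v ∉ X → ∀ M → (∀ {m} → m ∈ M → Dominates m × m ∈ X) →
    Spoked X v (_∈ M)
  spokes {v = v} dv v∉X [] _ = v ∷ [] , (λ { (here refl) (here refl) → here (here refl) }) ,
    here refl , (λ { (here refl) → v∉X }) , λ ()
  spokes dv v∉X (m ∷ M) dM with spoke dv (proj₁ (dM (here refl))) v∉X (proj₂ (dM (here refl)))
    | spokes dv v∉X M (dM ∘ there)
  ... | L , cL , v∈L , avL , adjL | K , cK , v∈K , avK , adjK =
    L ++ K , conn-++ cL cK v∈L v∈K , ∈-++⁺ˡ v∈L , [ avL , avK ]′ ∘ ∈-++⁻ L , λ
      { (here refl) → let a , i , e = adjL refl in a , ∈-++⁺ˡ i , e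
      ; (there j) → let a , i , e = adjK j in a , ∈-++⁺ʳ L i , e }

  -- Infinitely many dominating vertices are the hubs of a complete minor of countable order.
  complete-minor : (∀ X → Σ[ v ∈ V Γ ] v ∉ X × Dominates v) → QuadrantCells Γ
  complete-minor hubs = record
    -- All branch sets of a complete minor are pairwise adjacent, so any injective numbering of the
    -- cells will do.
    { cell = λ a b → _∈ L (pair a b)
    ; inhabited = λ a b → hub (pair a b) , hub∈ (pair a b)
    ; connected = λ a b → proj₁ (proj₂ (new (st (pair a b))))
    ; disjoint = λ i j → pair-injective (same i j)
    ; vertical = λ a b → joined λ eq → case pair-injective {a} {b} {a} {suc b} eq of λ ()
    ; horizontal = λ a b → joined λ eq → case pair-injective {a} {b} {suc a} {b} eq of λ ()
    }
    where
    -- `X` collects the branch sets built so far and `M` their hubs; a new branch set avoids `X` but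
    -- is adjacent to every vertex of `M`.
    record State : Set ℓ where
      field
        X M : List (V Γ)
        hubs-ok : ∀ {m} → m ∈ M → Dominates m × m ∈ X
    open State
    new : (s : State) → Spoked (X s) (proj₁ (hubs (X s))) (_∈ M s)
    new s = let v , v∉X , dv = hubs (X s) in spokes dv v∉X (M s) (hubs-ok s)
    step′ : State → State
    step′ s = let v , _ , dv = hubs (X s) ; L , _ , v∈L , _ = new s in record
      { X = L ++ X s ; M = v ∷ M s
      ; hubs-ok = λ { (here refl) → dv , ∈-++⁺ˡ v∈L
                    ; (there i) → let d , j = hubs-ok s i in d , ∈-++⁺ʳ L j } }
    st : ℕ → State
    st zero = record { X = [] ; M = [] ; hubs-ok = λ () }
    st (suc n) = step′ (st n)
    L : ℕ → List (V Γ)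
    L n = proj₁ (new (st n))
    hub : ℕ → V Γ
    hub n = proj₁ (hubs (X (st n)))
    hub∈ : ∀ n → hub n ∈ L n
    hub∈ n = proj₁ (proj₂ (proj₂ (new (st n))))
    old : ∀ {i j} → i < j → L i ⊆ X (st j) × hub i ∈ M (st j)
    old {i} {suc j} (s≤s i≤j) with m≤n⇒m<n∨m≡n i≤j
    ... | inj₁ i<j = ∈-++⁺ʳ (L j) ∘ proj₁ (old i<j) , there (proj₂ (old i<j))
    ... | inj₂ refl = ∈-++⁺ˡ , here refl
    apart : ∀ {i j x} → i < j → x ∈ L i → x ∉ L j
    apart {j = j} i<j x∈i x∈j = proj₁ (proj₂ (proj₂ (proj₂ (new (st j))))) x∈j (proj₁ (old i<j) x∈i)
    same : ∀ {i j x} → x ∈ L i → x ∈ L j → i ≡ j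
    same {i} {j} p q with <-cmp i j
    ... | tri< i<j _ _ = ⊥-elim (apart i<j p q)
    ... | tri≈ _ eq _ = eq
    ... | tri> _ _ j<i = ⊥-elim (apart j<i q p)
    adjacent : ∀ {i j} → i < j → Σ[ a ∈ V Γ ] a ∈ L j × Adj Γ a (hub i)
    adjacent {j = j} i<j = proj₂ (proj₂ (proj₂ (proj₂ (new (st j))))) (proj₂ (old i<j))
    joined : ∀ {i j} → i ≢ j → Σ[ x ∈ V Γ ] Σ[ y ∈ V Γ ] x ∈ L i × y ∈ L j × Adj Γ x y
    joined {i} {j} i≢j with <-cmp i j
    ... | tri< i<j _ _ = let a , a∈ , e = adjacent i<j in hub i , a , hub∈ i , a∈ , adj-sym e
    ... | tri≈ _ eq _ = ⊥-elim (i≢j eq)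
    ... | tri> _ _ j<i = let a , a∈ , e = adjacent j<i in a , hub j , a∈ , hub∈ j , e

  Undominated : ∀ {X₁} → Haven Γ X₁ → Set ℓ
  Undominated {X₁} H₁ = ∀ v → v ∉ X₁ → Σ[ X ∈ List (V Γ) ] v ∉ X × ¬ Haven.C H₁ X v

  -- Adds `Z` to the vertices deleted for good, which is how finitely many dominating vertices are
  -- disposed of.
  enlarge : ∀ Z → Haven Γ (Z ++ X₀)
  enlarge Z = record
    { C = λ X → C (X ++ Z)
    ; C-conn = λ X → C-conn (X ++ Z)
    ; C-avoid = λ c i → C-avoid c (∈-++⁺ˡ i)
    ; C-avoid₀ = λ {X} c i → [ (λ z → C-avoid c (∈-++⁺ʳ X z)) , C-avoid₀ c ]′ (∈-++⁻ Z i)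
    ; C-closed = λ {X} c e w∉X w∉ → C-closed c e
        (λ i → [ w∉X , w∉ ∘ ∈-++⁺ˡ ]′ (∈-++⁻ X i)) (λ i → w∉ (∈-++⁺ʳ Z i))
    ; C-mono = λ {X} {Y} X⊆Y → C-mono λ i → [ ∈-++⁺ˡ ∘ X⊆Y , ∈-++⁺ʳ Y ]′ (∈-++⁻ X i)
    ; C-inh = λ X → C-inh (X ++ Z)
    ; supply = λ n X → let Ss , len , disj , all = supply n (X ++ Z)
        in Ss , len , disj , All.map (λ s → let open EndSet s in record
          { conn = conn
          ; avoid = λ v∈ i → avoid v∈ (∈-++⁺ˡ i)
          ; avoid₀ = λ v∈ i → [ (λ j → avoid v∈ (∈-++⁺ʳ X j)) , avoid₀ v∈ ]′ (∈-++⁻ Z i)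
          ; meets = λ Y → meets (Y ++ Z) }) all
    }

  -- If the hubs run out, some finite `Z` contains all dominating vertices, and none is left after
  -- `enlarge Z`.
  dichotomy : QuadrantCells Γ ⊎ (Σ[ X₁ ∈ List (V Γ) ] Σ[ H₁ ∈ Haven Γ X₁ ] Undominated H₁)
  dichotomy with dec (∀ X → Σ[ v ∈ V Γ ] v ∉ X × Dominates v)
  ... | yes hubs = inj₁ (complete-minor hubs)
  ... | no ¬hubs = let Z , none = ¬∀⇒∃¬ ¬hubs in inj₂ (Z ++ X₀ , enlarge Z , λ v v∉ →
    ¬¬-elim λ dom → none (v , v∉ ∘ ∈-++⁺ˡ , λ X v∉X → ¬¬-elim λ ¬c →
      dom (X , v∉X , λ c → ¬c (C-mono ∈-++⁺ˡ c))))

-- Extremal principles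

AllPairs-lookup : ∀ {a r} {A : Set a} {R : A → A → Set r} → (∀ {x y} → R x y → R y x) →
  ∀ {xs} → AllPairs R xs → ∀ {i j} → i ≢ j → R (lookup xs i) (lookup xs j)
AllPairs-lookup sy (_ ∷ _) {zero} {zero} i≢j = ⊥-elim (i≢j refl)
AllPairs-lookup sy (r ∷ _) {zero} {suc j} _ = All.lookup r (∈-lookup j)
AllPairs-lookup sy (r ∷ _) {suc i} {zero} _ = sy (All.lookup r (∈-lookup i))
AllPairs-lookup sy (_ ∷ rs) {suc i} {suc j} i≢j = AllPairs-lookup sy rs (i≢j ∘ cong suc)

module Extrema (em : ∀ {ℓ} → ExcludedMiddle ℓ) where
  open Classical em

  abstract
    -- Move on to a larger witness while there is one. The fuel `d` bounds the distance to `N`,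
    -- beyond which there are no witnesses.
    last-such : ∀ {p} (P : ℕ → Set p) n N → P n → (∀ {m} → N ≤ m → ¬ P m) →
      Σ[ l ∈ ℕ ] n ≤ l × P l × (∀ {m} → l < m → ¬ P m)
    last-such P n N pn bound = search N n pn (m≤n+m N n)
      where
      search : ∀ d n → P n → N ≤ n + d → Σ[ l ∈ ℕ ] n ≤ l × P l × (∀ {m} → l < m → ¬ P m)
      search zero n pn N≤ = ⊥-elim (bound (subst (N ≤_) (+-identityʳ n) N≤) pn)
      search (suc d) n pn N≤ with dec (Σ[ m ∈ ℕ ] n < m × P m)
      ... | no none = n , ≤-refl , pn , λ n<m pm → none (_ , n<m , pm)
      ... | yes (m , n<m , pm) with search d m pm
              (≤-trans N≤ (subst (_≤ m + d) (sym (+-suc n d)) (+-monoˡ-≤ d n<m)))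
      ...   | l , m≤l , rest = l , ≤-trans (<⇒≤ n<m) m≤l , rest

  abstract
    -- The finite choice in König's lemma: if every entry of `L` failed from some stage on, all
    -- would fail at the maximum of these stages.
    uniform : ∀ {a f} {A : Set a} (F : A → ℕ → Set f) → (∀ {x m n} → m ≤ n → F x n → F x m) →
      ∀ L → (∀ m → Σ[ x ∈ A ] x ∈ L × F x m) → Σ[ x ∈ A ] x ∈ L × (∀ m → F x m)
    uniform F mono [] ex with ex 0
    ... | _ , () , _
    uniform F mono (x ∷ L) ex with dec (∀ m → F x m)
    ... | yes all = x , here refl , all
    ... | no ¬all with ¬∀⇒∃¬ ¬all
    ...   | m₀ , ¬f = let y , i , all = uniform F mono L ex′ in y , there i , all
      where
      ex′ : ∀ m → Σ[ y ∈ _ ] y ∈ L × F y m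
      ex′ m with ex (max m m₀)
      ... | _ , here refl , f = ⊥-elim (¬f (mono (m≤n⊔m m m₀) f))
      ... | y , there i , f = y , i , mono (m≤m⊔n m m₀) f

  Least : ∀ {p} → (ℕ → Set p) → ℕ → Set p
  Least P m = P m × (∀ {k} → P k → m ≤ k)

  abstract
    least : ∀ {p} (P : ℕ → Set p) n → P n → Σ[ m ∈ ℕ ] Least P m
    least P = <-rec (λ n → P n → Σ[ m ∈ ℕ ] Least P m) search
      where
      search : ∀ n → (∀ {m} → m < n → P m → Σ[ m ∈ ℕ ] Least P m) → P n → Σ[ m ∈ ℕ ] Least P m
      search n rec p with dec (Σ[ m ∈ ℕ ] m < n × P m)
      ... | yes (m , m<n , pm) = rec m<n pm
      ... | no none = n , p , λ pk → ≮⇒≥ λ k<n → none (_ , k<n , pk)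

-- Concatenating paths into a walk and erasing its loops

module Walks {ℓ} (Γ : Graph ℓ) where
  open Paths Γ

  -- Standing still is allowed because the last vertex of one path is repeated as the first vertex
  -- of the next.
  Lazy : (ℕ → V Γ) → Set ℓ
  Lazy w = ∀ n → w n ≡ w (suc n) ⊎ Adj Γ (w n) (w (suc n))

  module Concatenate (R : ℕ → VSet) (b : ℕ → V Γ) (π : ∀ i → PathIn Γ (R i) (b i) (b (suc i))) where

    Cursor : Set ℓ
    Cursor = Σ[ i ∈ ℕ ] Σ[ x ∈ V Γ ] PathIn Γ (R i) x (b (suc i))

    advance : Cursor → Cursor
    advance (i , _ , here _) = suc i , b (suc i) , π (suc i)
    advance (i , _ , step _ _ ps) = i , _ , ps

    cursor : ℕ → Cursor
    cursor zero = 0 , b 0 , π 0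
    cursor (suc n) = advance (cursor n)

    level : ℕ → ℕ
    level n = proj₁ (cursor n)

    walk : ℕ → V Γ
    walk n = proj₁ (proj₂ (cursor n))

    walk∈ : ∀ n → R (level n) (walk n)
    walk∈ n = source (proj₂ (proj₂ (cursor n)))

    lazy : Lazy walk
    lazy n with cursor n
    ... | i , _ , here _ = inj₁ refl
    ... | i , _ , step _ e _ = inj₂ e

    level-step : ∀ n → level n ≤ level (suc n)
    level-step n with cursor n
    ... | i , _ , here _ = n≤1+n i
    ... | i , _ , step _ _ _ = ≤-refl

    level-mono : ∀ {m n} → m ≤ n → level m ≤ level n
    level-mono {n = n} m≤n with m≤n⇒m<n∨m≡n m≤n
    level-mono {n = suc n} m≤n | inj₁ (s≤s m≤n′) = ≤-trans (level-mono m≤n′) (level-step n)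
    ... | inj₂ refl = ≤-refl

    finish : ∀ n {i x} (ps : PathIn Γ (R i) x (b (suc i))) → cursor n ≡ (i , x , ps) →
      Σ[ m ∈ ℕ ] level m ≡ suc i
    finish n (here _) eq = suc n , cong (proj₁ ∘ advance) eq
    finish n (step _ _ ps) eq = finish (suc n) ps (cong advance eq)

    level-unbounded : ∀ i → Σ[ n ∈ ℕ ] i ≤ level n
    level-unbounded zero = 0 , z≤n
    level-unbounded (suc i) with level-unbounded i
    ... | n , i≤ with finish n (proj₂ (proj₂ (cursor n))) refl
    ...   | m , eq = m , subst (suc i ≤_) (sym eq) (s≤s i≤)

  module Erase (em : ∀ {ℓ} → ExcludedMiddle ℓ) (w : ℕ → V Γ) (lazy : Lazy w)
    (transient : ∀ v → Σ[ N ∈ ℕ ] (∀ {m} → N ≤ m → w m ≢ v)) where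

    open Extrema em

    last-visit : ∀ n → Σ[ l ∈ ℕ ] n ≤ l × w l ≡ w n × (∀ {m} → l < m → w m ≢ w n)
    last-visit n = last-such (λ m → w m ≡ w n) n _ refl (proj₂ (transient (w n)))

    -- Loop erasure: wait for the last visit to the current vertex, then take the next step of the
    -- walk. No vertex left in this way can return.
    time : ℕ → ℕ
    time zero = proj₁ (last-visit 0)
    time (suc k) = proj₁ (last-visit (suc (time k)))

    gone : ∀ k {m} → time k < m → w m ≢ w (time k)
    gone zero lt eq = let _ , _ , same , g = last-visit 0 in g lt (trans eq same)
    gone (suc k) lt eq = let _ , _ , same , g = last-visit (suc (time k)) in g lt (trans eq same)

    time-step : ∀ k → time k < time (suc k)
    time-step k = proj₁ (proj₂ (last-visit (suc (time k))))

    time-mono : ∀ {i j} → i < j → time i < time j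
    time-mono {j = suc j} (s≤s i≤j) with m≤n⇒m<n∨m≡n i≤j
    ... | inj₁ i<j = <-trans (time-mono i<j) (time-step j)
    ... | inj₂ refl = time-step j

    n≤time : ∀ n → n ≤ time n
    n≤time zero = z≤n
    n≤time (suc n) = ≤-<-trans (n≤time n) (time-step n)

    erased-inj : ∀ {i j} → w (time i) ≡ w (time j) → i ≡ j
    erased-inj {i} {j} eq with <-cmp i j
    ... | tri< i<j _ _ = ⊥-elim (gone i (time-mono i<j) (sym eq))
    ... | tri≈ _ i≡j _ = i≡j
    ... | tri> _ _ j<i = ⊥-elim (gone j (time-mono j<i) eq)

    erased-adj : ∀ k → Adj Γ (w (time k)) (w (time (suc k)))
    erased-adj k with lazy (time k)
    ... | inj₁ eq = ⊥-elim (gone k ≤-refl (sym eq))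
    ... | inj₂ e = subst (Adj Γ _) (sym (proj₁ (proj₂ (proj₂ (last-visit (suc (time k))))))) e

-- Rays in an undominated end

record EndRay {ℓ} (Γ : Graph ℓ) (C : List (V Γ) → V Γ → Set ℓ) : Set ℓ where
  field
    at   : ℕ → V Γ
    adj  : ∀ n → Adj Γ (at n) (at (suc n))
    inj  : ∀ {m n} → at m ≡ at n → m ≡ n
    conv : ∀ X → Σ[ n ∈ ℕ ] (∀ {m} → n ≤ m → C X (at m))

module UndominatedEnd (em : ∀ {ℓ} → ExcludedMiddle ℓ) {ℓ} (Γ : Graph ℓ) {X₀ : List (V Γ)}
  (H : Haven Γ X₀)
  (undominated : ∀ v → v ∉ X₀ → Σ[ X ∈ List (V Γ) ] v ∉ X × ¬ Haven.C H X v) where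

  open Classical em
  open Extrema em
  open Paths Γ
  open Haven H
  open EndRay

  sep : V Γ → List (V Γ)
  sep v with dec (v ∈ X₀)
  -- A dummy value: `sep-sep` speaks only of vertices outside `X₀`.
  ... | yes _ = []
  ... | no v∉ = proj₁ (undominated v v∉)

  sep-sep : ∀ {v} → v ∉ X₀ → v ∉ sep v × ¬ C (sep v) v
  sep-sep {v} v∉ with dec (v ∈ X₀)
  ... | yes v∈ = ⊥-elim (v∉ v∈)
  ... | no v∉′ = proj₂ (undominated v v∉′)

  -- Each step adds the separators of all vertices present, so `Xs (suc n)` cuts every vertex of
  -- `Xs n` outside `X₀` off from the end.
  Xs : ℕ → List (V Γ)
  Xs zero = proj₁ (C-inh []) ∷ []
  Xs (suc n) = Xs n ++ concat (map sep (Xs n))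

  D : ℕ → VSet
  D n = C (Xs n)

  Xs-mono : ∀ {m n} → m ≤ n → Xs m ⊆ Xs n
  Xs-mono m≤n i with m≤n⇒m<n∨m≡n m≤n
  Xs-mono {n = suc n} _ i | inj₁ (s≤s m≤n) = ∈-++⁺ˡ (Xs-mono m≤n i)
  ... | inj₂ refl = i

  D-mono : ∀ {m n v} → m ≤ n → D n v → D m v
  D-mono m≤n = C-mono (Xs-mono m≤n)

  -- If `x` were in `Xs n`, then `y` would lie in `C (sep x)`, and so would its neighbour `x`,
  -- contrary to the choice of `sep x`.
  D-nbr : ∀ {n x y} → D (suc n) y → Adj Γ y x → x ∉ X₀ → D n x
  D-nbr {n} {x} dy e x∉X₀ = C-closed (D-mono (n≤1+n n) dy) e x∉Xs x∉X₀
    where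
    x∉Xs : x ∉ Xs n
    x∉Xs i = let x∉sep , ¬c = sep-sep x∉X₀ in
      ¬c (C-closed (C-mono (λ j → ∈-++⁺ʳ (Xs n) (∈-concat⁺′ j (∈-map⁺ sep i))) dy) e x∉sep x∉X₀)

  -- A path of length n from x to the vertex in Xs 0 leaves one D after another.
  D-empty : ∀ x → Σ[ n ∈ ℕ ] ¬ D n x
  D-empty x with dec (C [] x)
  ... | no ¬c = 0 , λ d → ¬c (C-mono (λ ()) d)
  ... | yes c = leave (C-conn [] c (proj₂ (C-inh [])))
    where
    leave : ∀ {x} → PathIn Γ (C []) x (proj₁ (C-inh [])) → Σ[ n ∈ ℕ ] ¬ D n x
    leave (here _) = 0 , λ d → C-avoid d (here refl)
    leave (step p e ps) = let n , ¬d = leave ps in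
      suc n , λ d → ¬d (D-nbr {n} d e (C-avoid₀ (source ps)))

  -- The sets `D n` form a neighbourhood basis of the end: for large `n` the connected set `D n`
  -- misses `X` and meets `C X`, hence lies in it.
  D-cofinal : ∀ X → Σ[ n ∈ ℕ ] (∀ {v} → D n v → C X v)
  D-cofinal X = n , inside
    where
    miss : ∀ X → Σ[ n ∈ ℕ ] (∀ {x} → x ∈ X → ¬ D n x)
    miss [] = 0 , λ ()
    miss (x ∷ X) = let m , ¬m = D-empty x ; k , ¬k = miss X in max m k , λ
      { (here refl) → ¬m ∘ D-mono (m≤m⊔n m k)
      ; (there i) → ¬k i ∘ D-mono (m≤n⊔m m k) }
    n = proj₁ (miss X)
    inside : ∀ {v} → D n v → C X v
    inside {v} d = let c , cc = C-inh (Xs n ++ X) in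
      proj₂ (target (along
        (λ cx e dy → C-closed cx e (λ i → proj₂ (miss X) i dy) (C-avoid₀ dy))
        (C-mono (∈-++⁺ʳ (Xs n)) cc) (C-conn (Xs n) (C-mono ∈-++⁺ˡ cc) d)))

  module _ {X : List (V Γ)} {S : VSet} (end : EndSet Γ X₀ C X S) where
    open EndSet end

    Good : VSet → V Γ → Set ℓ
    Good P b = ∀ m → Σ[ c ∈ V Γ ] D m c × PathIn Γ P b c

    -- König's lemma along the finite separators Xs.
    descend : ∀ {P b} n → (∀ {v} → P v → S v) → Good P b →
      Σ[ a ∈ V Γ ] PathIn Γ P b a × Good (λ v → S v × D n v) a
    descend {P} {b} n P⊆S good =
      let a , _ , all = uniform F F-mono (Xs (suc k)) exits
      in a , proj₁ (all 0) , λ m → let _ , c , d , ps = all m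
           in c , d , path-map (λ { (s , d) → s , D-mono n≤k d }) ps
      where
      -- With `b` outside `D (suc k)`, every path from `b` deep into the end has to cross the finite
      -- set `Xs (suc k)`.
      k = max n (proj₁ (D-empty b))
      n≤k : n ≤ k
      n≤k = m≤m⊔n n _
      b∉ : ¬ D (suc k) b
      b∉ d = proj₂ (D-empty b) (D-mono (≤-trans (m≤n⊔m n _) (n≤1+n k)) d)
      F : V Γ → ℕ → Set ℓ
      F a m = PathIn Γ P b a × Σ[ c ∈ V Γ ] D m c × PathIn Γ (λ v → S v × D k v) a c
      F-mono : ∀ {a m m′} → m ≤ m′ → F a m′ → F a m
      F-mono m≤ (ps , c , d , qs) = ps , c , D-mono m≤ d , qs
      -- The last vertex `a` outside `D (suc k)` has a neighbour in it. So `a` lies in `Xs (suc k)`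
      -- by closedness and in `D k` by `D-nbr`, and the rest of the path stays in `D k`.
      exits : ∀ m → Σ[ a ∈ V Γ ] a ∈ Xs (suc k) × F a m
      exits m with good (max m (suc k))
      ... | c , dc , ps with last-exit em (D (suc k)) ps b∉ (D-mono (m≤n⊔m m (suc k)) dc)
      ...   | a , a′ , ps₁ , ¬da , e , ps₂ = a , a∈ , ps₁ , c , D-mono (m≤m⊔n m (suc k)) dc ,
          step (P⊆S (target ps₁) , D-nbr {k} da′ (adj-sym e) a∉X₀) e
            (path-map (λ { (p , d) → P⊆S p , D-mono (n≤1+n k) d }) ps₂)
        where
        a∉X₀ = avoid₀ (P⊆S (target ps₁))
        da′ = proj₂ (source ps₂)
        a∈ : a ∈ Xs (suc k)
        a∈ = ¬¬-elim λ a∉ → ¬da (C-closed da′ (adj-sym e) a∉ a∉X₀)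

    record Stage : Set (lsuc ℓ) where
      field
        region : VSet
        region⊆ : ∀ {v} → region v → S v
        base : V Γ
        good : Good region base
    open Stage

    stage : ℕ → Stage
    stage zero = record
      { region = S ; region⊆ = id ; base = proj₁ (meets [])
      ; good = λ m → let c , s , d = meets (Xs m) in c , d , conn (proj₁ (proj₂ (meets []))) s }
    stage (suc n) = record
      { region = λ v → S v × D n v ; region⊆ = proj₁
      ; base = proj₁ next ; good = proj₂ (proj₂ next) }
      where next = descend n (region⊆ (stage n)) (good (stage n))

    link : ∀ n → PathIn Γ (region (stage n)) (base (stage n)) (base (stage (suc n)))
    link n = proj₁ (proj₂ (descend n (region⊆ (stage n)) (good (stage n))))

    private module W = Walks.Concatenate Γ (region ∘ stage) (base ∘ stage) link

    walk-conv : ∀ Y → Σ[ n ∈ ℕ ] (∀ {m} → n ≤ m → C Y (W.walk m))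
    walk-conv Y = let k , inside = D-cofinal Y ; n , lev = W.level-unbounded (suc k) in
      n , λ {m} n≤m → inside (region-D (≤-trans lev (W.level-mono n≤m)) (W.walk∈ m))
      where
      region-D : ∀ {i k v} → suc k ≤ i → region (stage i) v → D k v
      region-D (s≤s k≤i) (_ , d) = D-mono k≤i d

    walk-transient : ∀ v → Σ[ N ∈ ℕ ] (∀ {m} → N ≤ m → W.walk m ≢ v)
    walk-transient v = let n , c = walk-conv (v ∷ []) in n , λ n≤m eq → C-avoid (c n≤m) (here eq)

    private module E = Walks.Erase Γ em W.walk W.lazy walk-transient

    -- The links concatenate to a walk in `S`. Since link `suc n` runs inside `D n`, the walk
    -- converges to the end and visits each vertex only finitely often, so its loops can be erased.
    end-ray : Σ[ r ∈ EndRay Γ C ] (∀ n → S (at r n))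
    end-ray = record
      { at = W.walk ∘ E.time ; adj = E.erased-adj ; inj = E.erased-inj
      ; conv = λ Y → let n , c = walk-conv Y in n , λ {m} n≤m → c (≤-trans n≤m (E.n≤time m)) }
      , λ n → region⊆ (stage (W.level (E.time n))) (W.walk∈ (E.time n))

  DisjointRays : ∀ {n} → (Fin n → EndRay Γ C) → Set ℓ
  DisjointRays r = ∀ {i j} → i ≢ j → ∀ {m n} → at (r i) m ≢ at (r j) n

  ray-supply : ∀ n X → Σ[ r ∈ (Fin n → EndRay Γ C) ] DisjointRays r × (∀ i m → at (r i) m ∉ X)
  ray-supply n X with supply n X
  ... | Ss , n≤ , disj , all = (λ i → proj₁ (ray i)) ,
      (λ {i} {j} i≢j {m} {k} eq → AllPairs-lookup {R = Disj} (λ d t s → d s t) disj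
        (i≢j ∘ inject≤-injective n≤ n≤ i j)
        (proj₂ (ray i) m) (subst (lookup Ss (inject≤ j n≤)) (sym eq) (proj₂ (ray j) k))) ,
      λ i m → EndSet.avoid (end i) (proj₂ (ray i) m)
    where
    end : ∀ i → EndSet Γ X₀ C X (lookup Ss (inject≤ i n≤))
    end i = All.lookup all (∈-lookup (inject≤ i n≤))
    ray : ∀ i → Σ[ r ∈ EndRay Γ C ] (∀ m → lookup Ss (inject≤ i n≤) (at r m))
    ray i = end-ray (end i)

-- Stable matching of rays

abstract
  fin-bound : ∀ {p k} (P : Fin k → ℕ → Set p) →
    (∀ i → Σ[ N ∈ ℕ ] (∀ {m} → N ≤ m → P i m)) → Σ[ N ∈ ℕ ] (∀ i {m} → N ≤ m → P i m)
  fin-bound {k = zero} P ex = 0 , λ ()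
  fin-bound {k = suc k} P ex =
    let M , all = fin-bound (P ∘ suc) (ex ∘ suc) ; N , p = ex zero in max N M , λ
    { zero le → p (≤-trans (m≤m⊔n N M) le)
    ; (suc i) le → all i (≤-trans (m≤n⊔m N M) le) }

module Splice {a} {A : Set a} where

  -- Under `f m ≡ g 0` this joins two rays at a common vertex, which is listed only once.
  splice : (ℕ → A) → (ℕ → A) → ℕ → ℕ → A
  splice f g zero n = g n
  splice f g (suc m) zero = f 0
  splice f g (suc m) (suc n) = splice (f ∘ suc) g m n

  splice-cases : ∀ f g m n →
    (n < m × splice f g m n ≡ f n) ⊎ (Σ[ q ∈ ℕ ] n ≡ m + q × splice f g m n ≡ g q)
  splice-cases f g zero n = inj₂ (n , refl , refl)
  splice-cases f g (suc m) zero = inj₁ (s≤s z≤n , refl)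
  splice-cases f g (suc m) (suc n) with splice-cases (f ∘ suc) g m n
  ... | inj₁ (lt , eq) = inj₁ (s≤s lt , eq)
  ... | inj₂ (q , eq₁ , eq₂) = inj₂ (q , cong suc eq₁ , eq₂)

  splice-start : ∀ f g m → f m ≡ g 0 → splice f g m 0 ≡ f 0
  splice-start f g zero eq = sym eq
  splice-start f g (suc m) eq = refl

  splice-rel : ∀ {r} (R : A → A → Set r) f g m → f m ≡ g 0 →
    (∀ n → R (f n) (f (suc n))) → (∀ n → R (g n) (g (suc n))) →
    ∀ n → R (splice f g m n) (splice f g m (suc n))
  splice-rel R f g zero eq rf rg n = rg n
  splice-rel R f g (suc m) eq rf rg zero =
    subst (R (f 0)) (sym (splice-start (f ∘ suc) g m eq)) (rf 0)
  splice-rel R f g (suc m) eq rf rg (suc n) = splice-rel R (f ∘ suc) g m eq (rf ∘ suc) rg n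

-- Stable matching in place of Menger's theorem: every A i proposes to the rays B j in the order in
-- which it meets them, and every B j holds on to the proposal that lies furthest along B j.
module StableMatching (em : ∀ {ℓ} → ExcludedMiddle ℓ) {ℓ} (Γ : Graph ℓ)
  (C : List (V Γ) → V Γ → Set ℓ) {k : ℕ}
  (A : Fin k → EndRay Γ C)
  (A-disj : ∀ {i j} → i ≢ j → ∀ {m n} → EndRay.at (A i) m ≢ EndRay.at (A j) n)
  (B : Fin (suc k) → EndRay Γ C)
  (B-disj : ∀ {i j} → i ≢ j → ∀ {m n} → EndRay.at (B i) m ≢ EndRay.at (B j) n)
  where

  open Classical em
  open Extrema em
  open Splice

  a : Fin k → ℕ → V Γ
  a i = EndRay.at (A i)

  b : Fin (suc k) → ℕ → V Γ
  b j = EndRay.at (B j)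

  b-same : ∀ {j j′ m n} → b j m ≡ b j′ n → j ≡ j′
  b-same {j} {j′} eq with dec (j ≡ j′)
  ... | yes p = p
  ... | no ¬p = ⊥-elim (B-disj ¬p eq)

  Meets : Fin k → ℕ → Fin (suc k) → ℕ → Set ℓ
  Meets i n j p = a i n ≡ b j p

  -- Vacuously true while `A i` stands on no `B j`, so that it then simply moves on.
  Rejected : (Fin k → ℕ) → Fin k → Set ℓ
  Rejected f i = ∀ j p → Meets i (f i) j p →
    Σ[ i′ ∈ Fin k ] Σ[ p′ ∈ ℕ ] p < p′ × Meets i′ (f i′) j p′

  next : (Fin k → ℕ) → Fin k → ℕ
  next f i with dec (Rejected f i)
  ... | yes _ = suc (f i)
  ... | no _ = f i

  pos : ℕ → Fin k → ℕ
  pos zero _ = 0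
  pos (suc t) = next (pos t)

  next-rejected : ∀ {f i} → Rejected f i → next f i ≡ suc (f i)
  next-rejected {f} {i} r with dec (Rejected f i)
  ... | yes _ = refl
  ... | no ¬r = ⊥-elim (¬r r)

  next-held : ∀ {f i} → ¬ Rejected f i → next f i ≡ f i
  next-held {f} {i} ¬r with dec (Rejected f i)
  ... | yes r = ⊥-elim (¬r r)
  ... | no _ = refl

  next-cases : ∀ f i → next f i ≡ suc (f i) ⊎ next f i ≡ f i
  next-cases f i with dec (Rejected f i)
  ... | yes _ = inj₁ refl
  ... | no _ = inj₂ refl

  pos-step : ∀ t i → pos t i ≤ pos (suc t) i
  pos-step t i with next-cases (pos t) i
  ... | inj₁ eq = subst (pos t i ≤_) (sym eq) (n≤1+n _)
  ... | inj₂ eq = ≤-reflexive (sym eq)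

  pos-mono : ∀ {s t} → s ≤ t → ∀ i → pos s i ≤ pos t i
  pos-mono s≤t i with m≤n⇒m<n∨m≡n s≤t
  pos-mono {t = suc t} _ i | inj₁ (s≤s s≤t) = ≤-trans (pos-mono s≤t i) (pos-step t i)
  ... | inj₂ refl = ≤-refl

  Held : (Fin k → ℕ) → Fin (suc k) → ℕ → Set ℓ
  Held f j p = Σ[ i ∈ Fin k ] Meets i (f i) j p

  -- At most `k` positions lie on `B j`, so some proposal lies furthest along it. Nobody rejects
  -- that one, and it survives the round.
  best-held : ∀ f j {p} → Held f j p → Σ[ p′ ∈ ℕ ] p ≤ p′ × Held (next f) j p′
  best-held f j {p} held =
    let p′ , p≤p′ , (i , meet) , top = last-such (Held f j) p (proj₁ bound) held
                                         λ N≤ (i , meet) → proj₂ bound i N≤ meet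
        ¬rej : ¬ Rejected f i
        ¬rej rej = let i′ , _ , lt , meet′ = rej j p′ meet in top lt (i′ , meet′)
    in p′ , p≤p′ , i , subst (λ n → Meets i n j p′) (sym (next-held ¬rej)) meet
    where
    bound : Σ[ N ∈ ℕ ] (∀ i {q} → N ≤ q → ¬ Meets i (f i) j q)
    bound = fin-bound (λ i q → ¬ Meets i (f i) j q) λ i → case dec (Σ[ q ∈ ℕ ] Meets i (f i) j q) of λ
      { (no none) → 0 , λ {_} _ meet → none (_ , meet)
      ; (yes (q , meet)) → suc q , λ {q′} lt meet′ →
          <⇒≢ lt (EndRay.inj (B j) (trans (sym meet) meet′)) }

  Proposes : Fin k → ℕ → Set
  Proposes i n = Σ[ t ∈ ℕ ] n ≤ pos t i

  -- Positions advance by at most one per round, so each `n` up to `pos t i` was the actual position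
  -- in some round; from then on `best-held` applies.
  proposal-held : ∀ t {i n j p} → n ≤ pos t i → Meets i n j p →
    Σ[ p′ ∈ ℕ ] p ≤ p′ × Held (pos t) j p′
  proposal-held zero {i} {zero} {p = p} z≤n meet = p , ≤-refl , i , meet
  proposal-held (suc t) {i} {n} {j} {p} n≤ meet with n ≤? pos t i
  ... | yes n≤′ = let p₁ , p≤p₁ , held = proposal-held t n≤′ meet
                      p₂ , p₁≤p₂ , held′ = best-held (pos t) j held
                  in p₂ , ≤-trans p≤p₁ p₁≤p₂ , held′
  ... | no n≰ = p , ≤-refl , i , subst (λ n → Meets i n j p) n≡ meet
    where
    n≡ : n ≡ pos (suc t) i
    n≡ with next-cases (pos t) i
    ... | inj₁ eq = ≤-antisym n≤ (subst (_≤ n) (sym eq) (≰⇒> n≰))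
    ... | inj₂ eq = ⊥-elim (n≰ (subst (n ≤_) eq n≤))

  -- At any time at most k of the k + 1 rays B j hold a proposal.
  unproposed : Σ[ j ∈ Fin (suc k) ] (∀ {i n p} → Proposes i n → ¬ Meets i n j p)
  unproposed = ¬¬-elim λ none → clash (λ j → ¬¬-elim λ ¬p →
    none (j , λ {i n p} pr meet → ¬p (i , n , p , pr , meet)))
    where
    clash : ¬ (∀ j → Σ[ i ∈ Fin k ] Σ[ n ∈ ℕ ] Σ[ p ∈ ℕ ] Proposes i n × Meets i n j p)
    clash prop = let j , j′ , j<j′ , same = pigeonhole ≤-refl holder in
      Finₚ.<⇒≢ j<j′ (b-same (trans (sym (proj₂ (holds j)))
        (trans (cong (λ i → a i (pos T i)) same) (proj₂ (holds j′)))))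
      where
      times = fin-bound (λ j t → let i , n , _ = prop j in n ≤ pos t i)
        (λ j → let i , _ , _ , (t , n≤) , _ = prop j in t , λ t≤ → ≤-trans n≤ (pos-mono t≤ i))
      T = proj₁ times
      held : ∀ j → Σ[ p ∈ ℕ ] Held (pos T) j p
      held j = let p , _ , h = proposal-held T (proj₂ times j ≤-refl)
                               (proj₂ (proj₂ (proj₂ (proj₂ (prop j))))) in p , h
      holder : Fin (suc k) → Fin k
      holder j = proj₁ (proj₂ (held j))
      holds : ∀ j → Σ[ p ∈ ℕ ] Meets (holder j) (pos T (holder j)) j p
      holds j = proj₁ (held j) , proj₂ (proj₂ (held j))

  record Halt (i : Fin k) : Set ℓ where
    field
      m t p  : ℕ
      j      : Fin (suc k)
      stable : ∀ {t′} → t ≤ t′ → pos t′ i ≡ m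
      meet   : Meets i m j p

  -- If the positions are bounded, the largest one is never rejected. As rejection is vacuous off
  -- the rays `B j`, it must lie on one of them.
  halts-or-runs : ∀ i → Halt i ⊎ (∀ n → Proposes i n)
  halts-or-runs i with dec (∀ n → Proposes i n)
  ... | yes runs = inj₂ runs
  ... | no ¬runs = inj₁ halt
    where
    n₀ = proj₁ (¬∀⇒∃¬ ¬runs)
    largest = last-such (λ v → Σ[ t ∈ ℕ ] pos t i ≡ v) 0 n₀ (0 , refl)
      λ { n₀≤ (t , refl) → proj₂ (¬∀⇒∃¬ ¬runs) (t , n₀≤) }
    m = proj₁ largest
    t = proj₁ (proj₁ (proj₂ (proj₂ largest)))
    stable : ∀ {t′} → t ≤ t′ → pos t′ i ≡ m
    stable {t′} t≤t′ = ≤-antisym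
      (≮⇒≥ λ lt → proj₂ (proj₂ (proj₂ largest)) lt (t′ , refl))
      (subst (_≤ pos t′ i) (proj₂ (proj₁ (proj₂ (proj₂ largest)))) (pos-mono t≤t′ i))
    ¬rej : ¬ Rejected (pos t) i
    ¬rej rej = 1+n≢n (trans (sym (next-rejected {pos t} rej))
      (trans (stable (n≤1+n t)) (sym (stable ≤-refl))))
    met : Σ[ j ∈ Fin (suc k) ] Σ[ p ∈ ℕ ] Meets i (pos t i) j p
    met = ¬¬-elim λ none → ¬rej λ j p meet → ⊥-elim (none (j , p , meet))
    halt : Halt i
    halt = record { m = m ; t = t ; p = proj₁ (proj₂ met) ; j = proj₁ met ; stable = stable
                  ; meet = subst (λ n → Meets i n (proj₁ met) (proj₁ (proj₂ met)))
                           (stable ≤-refl) (proj₂ (proj₂ met)) }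

  halt-proposes : ∀ {i} (h : Halt i) → Proposes i (Halt.m h)
  halt-proposes h = let open Halt h in t , ≤-reflexive (sym (stable ≤-refl))

  -- A proposal beyond `p` would leave `B j` holding something better at a late time, and `A i`
  -- would be rejected after it had come to rest.
  halt-best : ∀ {i} (h : Halt i) {i′ n q} → Proposes i′ n → Meets i′ n (Halt.j h) q → q ≤ Halt.p h
  halt-best {i} h {i′} {n} {q} (t′ , n≤) meet′ =
    let open Halt h
        T = max t t′
        q′ , q≤q′ , i″ , meet″ = proposal-held T (≤-trans n≤ (pos-mono (m≤n⊔m t t′) i′)) meet′
        at-T : pos T i ≡ m
        at-T = stable (m≤m⊔n t t′)
        rej : p < q′ → Rejected (pos T) i
        rej lt j₁ p₁ meet₁ =
          let here₁ = trans (sym meet) (trans (cong (a i) (sym at-T)) meet₁)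
              j≡ : j ≡ j₁
              j≡ = b-same here₁
              p≡ : p ≡ p₁
              p≡ = EndRay.inj (B j) (trans here₁ (cong (λ j → b j p₁) (sym j≡)))
          in i″ , q′ , subst (_< q′) p≡ lt , trans meet″ (cong (λ j → b j q′) j≡)
    in ≤-trans q≤q′ (≮⇒≥ λ lt → 1+n≢n (trans (sym (next-rejected {pos T} (rej lt)))
         (trans (stable (≤-trans (m≤m⊔n t t′) (n≤1+n T))) (sym at-T))))

  Trace : Fin k → V Γ → Set ℓ
  Trace i x = (Σ[ n ∈ ℕ ] Proposes i n × x ≡ a i n) ⊎
    (Σ[ h ∈ Halt i ] Σ[ q ∈ ℕ ] Halt.p h ≤ q × x ≡ b (Halt.j h) q)

  Continues : Fin k → Set ℓ
  Continues i = Σ[ r ∈ EndRay Γ C ] EndRay.at r 0 ≡ a i 0 × (∀ n → Trace i (EndRay.at r n))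

  continue : ∀ i → Continues i
  continue i with halts-or-runs i
  ... | inj₂ runs = A i , refl , λ n → inj₁ (n , runs n , refl)
  ... | inj₁ h = record { at = at ; adj = splice-rel (Adj Γ) (a i) b′ m joint (EndRay.adj (A i)) adj′
                        ; inj = inj ; conv = conv } , splice-start (a i) b′ m joint , trace
    where
    open Halt h
    b′ : ℕ → V Γ
    b′ q = b j (p + q)
    joint : a i m ≡ b′ 0
    joint = trans meet (cong (b j) (sym (+-identityʳ p)))
    adj′ : ∀ n → Adj Γ (b′ n) (b′ (suc n))
    adj′ n = subst (λ q → Adj Γ (b j (p + n)) (b j q)) (sym (+-suc p n)) (EndRay.adj (B j) (p + n))
    at : ℕ → V Γ
    at = splice (a i) b′ m
    proposes : ∀ {n} → n < m → Proposes i n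
    proposes lt = let t , m≤ = halt-proposes h in t , ≤-trans (<⇒≤ lt) m≤
    -- An earlier meeting with `B j` at or beyond `p` could only be at `p` itself, by `halt-best`,
    -- and that vertex is already `a i m`.
    apart : ∀ {n q} → n < m → a i n ≢ b′ q
    apart {n} {q} n<m eq = <⇒≢ n<m (EndRay.inj (A i) (trans eq (trans (cong (b j) pos≡) (sym meet))))
      where
      pos≡ : p + q ≡ p
      pos≡ = ≤-antisym (halt-best h (proposes n<m) eq) (m≤m+n p q)
    inj : ∀ {n n′} → at n ≡ at n′ → n ≡ n′
    inj {n} {n′} eq with splice-cases (a i) b′ m n | splice-cases (a i) b′ m n′
    ... | inj₁ (_ , e) | inj₁ (_ , e′) = EndRay.inj (A i) (trans (sym e) (trans eq e′))
    ... | inj₁ (lt , e) | inj₂ (_ , _ , e′) = ⊥-elim (apart lt (trans (sym e) (trans eq e′)))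
    ... | inj₂ (_ , _ , e) | inj₁ (lt , e′) = ⊥-elim (apart lt (trans (sym e′) (trans (sym eq) e)))
    ... | inj₂ (q , n≡ , e) | inj₂ (q′ , n′≡ , e′) = trans n≡ (trans (cong (_+_ m)
      (+-cancelˡ-≡ p q q′ (EndRay.inj (B j) (trans (sym e) (trans eq e′))))) (sym n′≡))
    conv : ∀ X → Σ[ n ∈ ℕ ] (∀ {n′} → n ≤ n′ → C X (at n′))
    conv X with EndRay.conv (B j) X
    ... | N , c = m + N , late
      where
      late : ∀ {n′} → m + N ≤ n′ → C X (at n′)
      late {n′} le with splice-cases (a i) b′ m n′
      ... | inj₁ (lt , _) = ⊥-elim (<⇒≱ lt (≤-trans (m≤m+n m N) le))
      ... | inj₂ (q , refl , e) = subst (C X) (sym e) (c (≤-trans (+-cancelˡ-≤ m N q le) (m≤n+m q p)))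
    trace : ∀ n → Trace i (at n)
    trace n with splice-cases (a i) b′ m n
    ... | inj₁ (lt , e) = inj₁ (n , proposes lt , e)
    ... | inj₂ (q , _ , e) = inj₂ (h , p + q , m≤m+n p q , e)

  old : Fin k → EndRay Γ C
  old i = proj₁ (continue i)

  old-start : ∀ i → EndRay.at (old i) 0 ≡ a i 0
  old-start i = proj₁ (proj₂ (continue i))

  new : EndRay Γ C
  new = B (proj₁ unproposed)

  -- By `halt-best` such a meeting would be at `p`, where the other ray `A i′` halts; but the rays
  -- of `A` are disjoint.
  trace-A-B : ∀ {i i′ n q} → i ≢ i′ → (h : Halt i′) → Proposes i n → Halt.p h ≤ q → a i n ≢ b (Halt.j h) q
  trace-A-B i≢i′ h pr p≤q eq = A-disj i≢i′ (trans eq (trans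
    (cong (b (Halt.j h)) (≤-antisym (halt-best h pr eq) p≤q)) (sym (Halt.meet h))))

  trace-disj : ∀ {i i′ x} → i ≢ i′ → Trace i x → ¬ Trace i′ x
  trace-disj i≢i′ (inj₁ (_ , _ , e)) (inj₁ (_ , _ , e′)) = A-disj i≢i′ (trans (sym e) e′)
  trace-disj i≢i′ (inj₁ (_ , pr , e)) (inj₂ (h , _ , p≤q , e′)) = trace-A-B i≢i′ h pr p≤q (trans (sym e) e′)
  trace-disj i≢i′ (inj₂ (h , _ , p≤q , e)) (inj₁ (_ , pr , e′)) =
    trace-A-B (i≢i′ ∘ sym) h pr p≤q (trans (sym e′) e)
  trace-disj i≢i′ (inj₂ (h , q , p≤q , e)) (inj₂ (h′ , q′ , p′≤q′ , e′)) =
    trace-A-B i≢i′ h′ (halt-proposes h) (halt-best h (halt-proposes h′) meet′)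
      (trans (Halt.meet h) (cong (λ j → b j (Halt.p h)) j≡))
    where
    j≡ : Halt.j h ≡ Halt.j h′
    j≡ = b-same (trans (sym e) e′)
    meet′ = trans (Halt.meet h′) (cong (λ j → b j (Halt.p h′)) (sym j≡))

  old-disj : ∀ {i i′} → i ≢ i′ → ∀ {m n} → EndRay.at (old i) m ≢ EndRay.at (old i′) n
  old-disj {i} {i′} i≢i′ {m} {n} eq = trace-disj i≢i′ (proj₂ (proj₂ (continue i)) m)
    (subst (Trace i′) (sym eq) (proj₂ (proj₂ (continue i′)) n))

  -- Halting on a ray is a proposal to it, and `new` receives none.
  trace-new : ∀ {i x n} → Trace i x → x ≢ EndRay.at new n
  trace-new (inj₁ (_ , pr , e)) eq = proj₂ unproposed pr (trans (sym e) eq)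
  trace-new (inj₂ (h , _ , _ , e)) eq = proj₂ unproposed (halt-proposes h)
    (trans (Halt.meet h) (cong (λ j → b j (Halt.p h)) (b-same (trans (sym e) eq))))

  new-disj : ∀ i {m n} → EndRay.at (old i) m ≢ EndRay.at new n
  new-disj i {m} = trace-new (proj₂ (proj₂ (continue i)) m)

  old-from : ∀ i n → (Σ[ m ∈ ℕ ] EndRay.at (old i) n ≡ a i m) ⊎
    (Σ[ j ∈ Fin (suc k) ] Σ[ m ∈ ℕ ] EndRay.at (old i) n ≡ b j m)
  old-from i n = from (proj₂ (proj₂ (continue i)) n)
    where
    from : ∀ {x} → Trace i x →
      (Σ[ m ∈ ℕ ] x ≡ a i m) ⊎ (Σ[ j ∈ Fin (suc k) ] Σ[ m ∈ ℕ ] x ≡ b j m)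
    from (inj₁ (m , _ , e)) = inj₁ (m , e)
    from (inj₂ (h , q , _ , e)) = inj₂ (Halt.j h , q , e)

-- Towers of zones crossed by more and more rays

record Tower {ℓ} (Γ : Graph ℓ) : Set ℓ where
  open Paths Γ
  field
    Z        : ℕ → List (V Γ)
    -- The ray `R i` appears only through its pieces `seg t i` for `t ≥ i`, because every matching
    -- reroutes what lies beyond the current zone. For `i > t` the value is a filler.
    seg      : ℕ → ℕ → List (V Γ)
    Z-conn   : ∀ t → Conn (_∈ Z t)
    Z-disj   : ∀ {s t x} → s < t → x ∈ Z s → x ∉ Z t
    seg⊆     : ∀ {t i} → i ≤ t → seg t i ⊆ Z t
    seg-inh  : ∀ t i → Σ[ x ∈ V Γ ] x ∈ seg t i
    seg-conn : ∀ t i → Conn (_∈ seg t i)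
    seg-disj : ∀ {t i j x} → i ≤ t → j ≤ t → x ∈ seg t i → x ∈ seg t j → i ≡ j
    seg-next : ∀ {t i} → i ≤ t →
      Σ[ x ∈ V Γ ] Σ[ y ∈ V Γ ] x ∈ seg t i × y ∈ seg (suc t) i × Adj Γ x y

module BuildTower (em : ∀ {ℓ} → ExcludedMiddle ℓ) {ℓ} (Γ : Graph ℓ) {X₀ : List (V Γ)}
  (H : Haven Γ X₀)
  (ray-supply : ∀ n X → Σ[ r ∈ (Fin n → EndRay Γ (Haven.C H)) ]
    (∀ {i j} → i ≢ j → ∀ {m k} → EndRay.at (r i) m ≢ EndRay.at (r j) k) ×
    (∀ i m → EndRay.at (r i) m ∉ X)) where

  open Paths Γ
  open Haven H
  open EndRay

  Ray : Set ℓ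
  Ray = EndRay Γ C

  drop-ray : ℕ → Ray → Ray
  drop-ray n r = record
    { at = λ m → at r (n + m)
    ; adj = λ m → subst (λ q → Adj Γ (at r (n + m)) (at r q)) (sym (+-suc n m)) (adj r (n + m))
    ; inj = λ {m} {m′} eq → +-cancelˡ-≡ n m m′ (inj r eq)
    ; conv = λ X → let N , c = conv r X in N , λ {m} le → c (≤-trans le (m≤n+m m n)) }

  initial : Ray → ℕ → List (V Γ)
  initial r n = applyUpTo (at r) (suc n)

  initial-conn : ∀ r n → Conn (_∈ initial r n)
  initial-conn r n = conn-from (at r 0) λ i →
    let m , m<n , eq = ∈-applyUpTo⁻ (at r) i in subst (PathIn Γ _ _) (sym eq) (upTo m m<n)
    where
    upTo : ∀ m → m < suc n → PathIn Γ (_∈ initial r n) (at r 0) (at r m)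
    upTo zero lt = here (∈-applyUpTo⁺ (at r) lt)
    upTo (suc m) lt = let ps = upTo m (<-trans (n<1+n m) lt) in
      ps ⊕ edge (target ps) (adj r m) (∈-applyUpTo⁺ (at r) lt)

  record State (t : ℕ) : Set ℓ where
    field
      X     : List (V Γ)
      ray   : ℕ → Ray
      disj  : ∀ {i j} → i ≤ t → j ≤ t → i ≢ j → ∀ {m n} → at (ray i) m ≢ at (ray j) n
      avoid : ∀ {i} → i ≤ t → ∀ m → at (ray i) m ∉ X

    -- A star of paths in `C X` from a hub on ray 0 to a vertex on each of the other rays up to `k`.
    gather : ∀ k → Σ[ P ∈ List (V Γ) ] Conn (_∈ P) × at (ray 0) (proj₁ (conv (ray 0) X)) ∈ P ×
      (∀ {z} → z ∈ P → C X z) × (∀ {i} → i ≤ k → Σ[ n ∈ ℕ ] at (ray i) n ∈ P)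
    gather zero = _ ∷ [] , (λ { (here refl) (here refl) → here (here refl) }) , here refl ,
      (λ { (here refl) → proj₂ (conv (ray 0) X) ≤-refl }) , λ { z≤n → _ , here refl }
    gather (suc k) with gather k
    ... | P , cP , hub , inC , hits =
      P ++ Q , conn-++ cP (verts-conn ps) hub (source∈ ps) , ∈-++⁺ˡ hub ,
      [ inC , verts-all ps ]′ ∘ ∈-++⁻ P , λ i≤ → case m≤n⇒m<n∨m≡n i≤ of λ
        { (inj₁ (s≤s i≤k)) → let n , n∈ = hits i≤k in n , ∈-++⁺ˡ n∈
        ; (inj₂ refl) → _ , ∈-++⁺ʳ P (target∈ ps) }
      where
      ps = C-conn X (proj₂ (conv (ray 0) X) ≤-refl) (proj₂ (conv (ray (suc k)) X) ≤-refl)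
      Q = verts ps

    P : List (V Γ)
    P = proj₁ (gather t)

    -- From here on the ray lies in `C P` and so misses `P`. Hence the segment up to `cut i`
    -- contains the vertex at which `gather` reached the ray, and the rest of the ray is free of the
    -- zone.
    cut : ℕ → ℕ
    cut i = proj₁ (conv (ray i) P)

    beyond : ∀ i {m} → cut i ≤ m → at (ray i) m ∉ P
    beyond i le = C-avoid (proj₂ (conv (ray i) P) le)

    segment : ℕ → List (V Γ)
    segment i = initial (ray i) (cut i)

    P-segment : ∀ {i} → i ≤ t → Σ[ x ∈ V Γ ] x ∈ P × x ∈ segment i
    P-segment {i} i≤t = let n , n∈ = proj₂ (proj₂ (proj₂ (proj₂ (gather t)))) i≤t in
      at (ray i) n , n∈ , ∈-applyUpTo⁺ (at (ray i)) (s≤s (<⇒≤ (≰⇒> λ le → beyond i le n∈)))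

    P-segments : ℕ → List (V Γ)
    P-segments zero = P ++ segment 0
    P-segments (suc k) = P-segments k ++ segment (suc k)

    P⊆ : ∀ k → P ⊆ P-segments k
    P⊆ zero = ∈-++⁺ˡ
    P⊆ (suc k) = ∈-++⁺ˡ ∘ P⊆ k

    segment⊆ : ∀ {k i} → i ≤ k → segment i ⊆ P-segments k
    segment⊆ {zero} z≤n = ∈-++⁺ʳ P
    segment⊆ {suc k} i≤ z with m≤n⇒m<n∨m≡n i≤
    ... | inj₁ (s≤s i≤k) = ∈-++⁺ˡ (segment⊆ i≤k z)
    ... | inj₂ refl = ∈-++⁺ʳ (P-segments k) z

    from-P-segments : ∀ {k z} → z ∈ P-segments k → z ∈ P ⊎ (Σ[ i ∈ ℕ ] i ≤ k × z ∈ segment i)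
    from-P-segments {zero} z with ∈-++⁻ P z
    ... | inj₁ p = inj₁ p
    ... | inj₂ s = inj₂ (0 , z≤n , s)
    from-P-segments {suc k} z with ∈-++⁻ (P-segments k) z
    ... | inj₂ s = inj₂ (suc k , ≤-refl , s)
    ... | inj₁ z′ with from-P-segments z′
    ...   | inj₁ p = inj₁ p
    ...   | inj₂ (i , i≤k , s) = inj₂ (i , ≤-trans i≤k (n≤1+n k) , s)

    P-segments-conn : ∀ {k} → k ≤ t → Conn (_∈ P-segments k)
    P-segments-conn {zero} k≤t = let _ , x∈P , x∈s = P-segment z≤n in
      conn-++ (proj₁ (proj₂ (gather t))) (initial-conn (ray 0) (cut 0)) x∈P x∈s
    P-segments-conn {suc k} k≤t = let _ , x∈P , x∈s = P-segment k≤t in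
      conn-++ (P-segments-conn (≤-trans (n≤1+n k) k≤t))
        (initial-conn (ray (suc k)) (cut (suc k))) (P⊆ k x∈P) x∈s

    zone : List (V Γ)
    zone = P-segments t

    zone-avoid : ∀ {x} → x ∈ zone → x ∉ X
    zone-avoid x∈ with from-P-segments x∈
    ... | inj₁ p = C-avoid (proj₁ (proj₂ (proj₂ (proj₂ (gather t)))) p)
    ... | inj₂ (i , i≤t , s) = let m , _ , eq = ∈-applyUpTo⁻ (at (ray i)) s in
      subst (_∉ X) (sym eq) (avoid i≤t m)

    X′ : List (V Γ)
    X′ = zone ++ X

    tail : ℕ → Ray
    tail i = drop-ray (suc (cut i)) (ray i)

    tail-avoid : ∀ {i} → i ≤ t → ∀ m → at (tail i) m ∉ X′
    tail-avoid {i} i≤t m x∈ with ∈-++⁻ zone x∈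
    ... | inj₂ x∈X = avoid i≤t _ x∈X
    ... | inj₁ x∈zone with from-P-segments x∈zone
    ...   | inj₁ p = beyond i (≤-trans (n≤1+n _) (m≤m+n _ m)) p
    ...   | inj₂ (j , j≤t , s) with ∈-applyUpTo⁻ (at (ray j)) s | i ≟ j
    ...     | n , lt , eq | yes refl = <⇒≢ (≤-trans lt (m≤m+n _ m)) (sym (inj (ray i) eq))
    ...     | n , _ , eq | no i≢j = disj i≤t j≤t i≢j eq

    A : Fin (suc t) → Ray
    A i = tail (toℕ i)

    A-disj : ∀ {i j} → i ≢ j → ∀ {m n} → at (A i) m ≢ at (A j) n
    A-disj {i} {j} i≢j = disj (Finₚ.toℕ≤pred[n] i) (Finₚ.toℕ≤pred[n] j) (i≢j ∘ toℕ-injective)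

    B : Fin (suc (suc t)) → Ray
    B = proj₁ (ray-supply (suc (suc t)) X′)

    B-disj : ∀ {i j} → i ≢ j → ∀ {m n} → at (B i) m ≢ at (B j) n
    B-disj = proj₁ (proj₂ (ray-supply (suc (suc t)) X′))

    B-avoid : ∀ i m → at (B i) m ∉ X′
    B-avoid = proj₂ (proj₂ (ray-supply (suc (suc t)) X′))

    module Match = StableMatching em Γ C A A-disj B B-disj

    -- The old rays keep their index and their first vertex; the ray gained from the matching gets
    -- the index `suc t`.
    pick : ∀ {i} → Dec (i ≤ t) → Ray
    pick (yes i≤t) = Match.old (fromℕ< (s≤s i≤t))
    pick (no _) = Match.new

    pick-start : ∀ {i} (d : Dec (i ≤ t)) → i ≤ t → at (pick d) 0 ≡ at (tail i) 0
    pick-start (yes p) _ = trans (Match.old-start (fromℕ< (s≤s p)))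
      (cong (λ j → at (tail j) 0) (Finₚ.toℕ-fromℕ< (s≤s p)))
    pick-start (no ¬p) p = ⊥-elim (¬p p)

    pick-disj : ∀ {i j} (d : Dec (i ≤ t)) (d′ : Dec (j ≤ t)) → i ≤ suc t → j ≤ suc t → i ≢ j →
      ∀ {m n} → at (pick d) m ≢ at (pick d′) n
    pick-disj (yes p) (yes q) _ _ i≢j = Match.old-disj λ eq →
      i≢j (trans (sym (Finₚ.toℕ-fromℕ< (s≤s p))) (trans (cong toℕ eq) (Finₚ.toℕ-fromℕ< (s≤s q))))
    pick-disj (yes p) (no _) _ _ _ eq = Match.new-disj (fromℕ< (s≤s p)) eq
    pick-disj (no _) (yes q) _ _ _ eq = Match.new-disj (fromℕ< (s≤s q)) (sym eq)
    pick-disj (no ¬p) (no ¬q) i≤ j≤ i≢j =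
      ⊥-elim (i≢j (trans (≤-antisym i≤ (≰⇒> ¬p)) (≤-antisym (≰⇒> ¬q) j≤)))

    pick-avoid : ∀ {i} (d : Dec (i ≤ t)) → ∀ m → at (pick d) m ∉ X′
    pick-avoid (no _) m = B-avoid (proj₁ Match.unproposed) m
    pick-avoid (yes p) m = from (Match.old-from (fromℕ< (s≤s p)) m)
      where
      i = fromℕ< (s≤s p)
      from : ∀ {x} → (Σ[ n ∈ ℕ ] x ≡ at (A i) n) ⊎
        (Σ[ j ∈ Fin (suc (suc t)) ] Σ[ n ∈ ℕ ] x ≡ at (B j) n) → x ∉ X′
      from (inj₁ (n , eq)) = subst (_∉ X′) (sym eq) (tail-avoid (Finₚ.toℕ≤pred[n] i) n)
      from (inj₂ (j , n , eq)) = subst (_∉ X′) (sym eq) (B-avoid j n)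

    ray′ : ℕ → Ray
    ray′ i = pick (i ≤? t)

    next : State (suc t)
    next = record { X = X′ ; ray = ray′
                ; disj = λ {i} {j} → pick-disj (i ≤? t) (j ≤? t)
                ; avoid = λ {i} _ → pick-avoid (i ≤? t) }

  open State using (X; ray; cut; segment; zone)

  state : ∀ t → State t
  state zero = let r , _ , avoid = ray-supply 1 [] in record
    { X = [] ; ray = λ _ → r zero
    ; disj = λ { z≤n z≤n i≢j → ⊥-elim (i≢j refl) }
    ; avoid = λ _ m → avoid zero m }
  state (suc t) = State.next (state t)

  zone⊆X : ∀ {s t} → s < t → zone (state s) ⊆ X (state t)
  zone⊆X {s} {suc t} (s≤s s≤t) z with m≤n⇒m<n∨m≡n s≤t
  ... | inj₁ s<t = ∈-++⁺ʳ (zone (state t)) (zone⊆X s<t z)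
  ... | inj₂ refl = ∈-++⁺ˡ z

  tower : Tower Γ
  tower = record
    { Z = λ t → zone (state t)
    ; seg = λ t i → segment (state t) i
    ; Z-conn = λ t → State.P-segments-conn (state t) ≤-refl
    ; Z-disj = λ {s} {t} s<t x∈s x∈t → State.zone-avoid (state t) x∈t (zone⊆X s<t x∈s)
    ; seg⊆ = λ {t} i≤t → State.segment⊆ (state t) i≤t
    ; seg-inh = λ t i → _ , here refl
    ; seg-conn = λ t i → initial-conn (ray (state t) i) (cut (state t) i)
    ; seg-disj = λ {t} {i} {j} → seg-disj t i j
    -- The segment ends at index `n`, the tail begins at `suc n`, and rerouting keeps the beginning
    -- of the tail.
    ; seg-next = λ {t} {i} i≤t → let r = ray (state t) i ; n = cut (state t) i in
        at r n , at r (suc n) , ∈-applyUpTo⁺ (at r) ≤-refl ,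
        here (trans (cong (at r) (sym (+-identityʳ (suc n))))
               (sym (State.pick-start (state t) (i ≤? t) i≤t))) ,
        adj r n
    }
    where
    seg-disj : ∀ t i j {x} → i ≤ t → j ≤ t → x ∈ segment (state t) i → x ∈ segment (state t) j → i ≡ j
    seg-disj t i j i≤ j≤ p q with i ≟ j
    ... | yes eq = eq
    ... | no i≢j = let _ , _ , e = ∈-applyUpTo⁻ (at (ray (state t) i)) p
                       _ , _ , e′ = ∈-applyUpTo⁻ (at (ray (state t) j)) q
                   in ⊥-elim (State.disj (state t) i≤ j≤ i≢j (trans (sym e) e′))

-- The breadth-first order in a zone

module ZoneOrder (em : ∀ {ℓ} → ExcludedMiddle ℓ) {ℓ} (Γ : Graph ℓ) (t : ℕ)
  (Z : List (V Γ)) (Z-conn : Paths.Conn Γ (_∈ Z))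
  (seg : ℕ → List (V Γ))
  (seg⊆ : ∀ {i} → i ≤ t → seg i ⊆ Z)
  (seg-inh : ∀ i → Σ[ x ∈ V Γ ] x ∈ seg i)
  (seg-conn : ∀ i → Paths.Conn Γ (_∈ seg i))
  (seg-disj : ∀ {i j x} → i ≤ t → j ≤ t → x ∈ seg i → x ∈ seg j → i ≡ j)
  where

  open Classical em
  open Extrema em
  open Paths Γ

  root : V Γ
  root = proj₁ (seg-inh 0)

  root∈ : root ∈ Z
  root∈ = seg⊆ z≤n (proj₂ (seg-inh 0))

  infix 4 _≈_

  -- Equality of vertices after contraction; it is transitive because the segments are disjoint.
  _≈_ : V Γ → V Γ → Set ℓ
  x ≈ y = x ≡ y ⊎ (Σ[ i ∈ ℕ ] i ≤ t × x ∈ seg i × y ∈ seg i)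

  ≈-trans : ∀ {x y z} → x ≈ y → y ≈ z → x ≈ z
  ≈-trans (inj₁ refl) q = q
  ≈-trans p@(inj₂ _) (inj₁ refl) = p
  ≈-trans (inj₂ (i , i≤ , p , q)) (inj₂ (j , j≤ , r , s)) with seg-disj i≤ j≤ q r
  ... | refl = inj₂ (i , i≤ , p , s)

  ≈-sym : ∀ {x y} → x ≈ y → y ≈ x
  ≈-sym (inj₁ refl) = inj₁ refl
  ≈-sym (inj₂ (i , i≤ , p , q)) = inj₂ (i , i≤ , q , p)

  -- Breadth-first search from root in the graph obtained from Z by contracting every seg i.
  Reach : ℕ → V Γ → Set ℓ
  Reach zero x = x ≈ root
  Reach (suc k) x = Σ[ x′ ∈ V Γ ] Σ[ y ∈ V Γ ] x ≈ x′ × Adj Γ x′ y × y ∈ Z × Reach k y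

  reach-≈ : ∀ {k x y} → x ≈ y → Reach k y → Reach k x
  reach-≈ {zero} e r = ≈-trans e r
  reach-≈ {suc k} e (x′ , y , e′ , rest) = x′ , y , ≈-trans e e′ , rest

  reach : ∀ {x} → x ∈ Z → Σ[ k ∈ ℕ ] Reach k x
  reach x∈ = go (Z-conn x∈ root∈)
    where
    go : ∀ {x} → PathIn Γ (_∈ Z) x root → Σ[ k ∈ ℕ ] Reach k x
    go (here _) = 0 , inj₁ refl
    go (step _ e ps) = let k , r = go ps in suc k , _ , _ , inj₁ refl , e , source ps , r

  rank : V Γ → ℕ
  rank x with dec (Σ[ k ∈ ℕ ] Reach k x)
  ... | yes (k , r) = proj₁ (least (λ k → Reach k x) k r)
  -- A default that no vertex of `Z` receives, by `reach`.
  ... | no _ = 0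

  rank-least : ∀ {k x} → Reach k x → Least (λ k → Reach k x) (rank x)
  rank-least {k} {x} r with dec (Σ[ k ∈ ℕ ] Reach k x)
  ... | yes (k′ , r′) = proj₂ (least (λ k → Reach k x) k′ r′)
  ... | no none = ⊥-elim (none (k , r))

  rank-≈ : ∀ {x y} → x ≈ y → rank x ≡ rank y
  rank-≈ (inj₁ refl) = refl
  rank-≈ e@(inj₂ (i , i≤ , p , q)) =
    let k , r = reach (seg⊆ i≤ p) ; l , s = reach (seg⊆ i≤ q)
        rx , minx = rank-least r ; ry , miny = rank-least s
    in ≤-antisym (minx (reach-≈ e ry)) (miny (reach-≈ (≈-sym e) rx))

  -- Any edge to a smaller rank may be used, not just those of one search tree; a `jump` is a move
  -- inside a contracted segment.
  data Desc : V Γ → V Γ → Set ℓ where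
    stop : ∀ {x} → Desc x x
    jump : ∀ {i x x′ y} → i ≤ t → x ∈ seg i → x′ ∈ seg i → Desc x′ y → Desc x y
    down : ∀ {x z y} → Adj Γ x z → z ∈ Z → rank z < rank x → Desc z y → Desc x y

  jump-≈ : ∀ {x x′ y} → x ≈ x′ → Desc x′ y → Desc x y
  jump-≈ (inj₁ refl) d = d
  jump-≈ (inj₂ (i , i≤ , p , q)) d = jump i≤ p q d

  desc-root : ∀ {x} → x ∈ Z → Desc x root
  desc-root {x} x∈ = go (suc (rank x)) x∈ ≤-refl
    where
    go : ∀ n {x} → x ∈ Z → rank x < n → Desc x root
    go (suc n) {x} x∈ (s≤s r≤) with rank x in eq | proj₁ (rank-least (proj₂ (reach x∈)))
    ... | zero | e = jump-≈ e stop
    ... | suc k | x′ , y , e , a , y∈ , r =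
      jump-≈ e (down a y∈ (≤-<-trans y≤k (subst (k <_) (trans (sym eq) (rank-≈ e)) ≤-refl))
        (go n y∈ (≤-<-trans y≤k r≤)))
      where
      y≤k : rank y ≤ k
      y≤k = proj₂ (rank-least r) r

  -- Jumps keep the rank and downward edges lower it, so the rank stays equal only inside one
  -- contracted class. This gives antisymmetry.
  desc-rank : ∀ {x y} → Desc x y → rank y < rank x ⊎ x ≈ y
  desc-rank stop = inj₂ (inj₁ refl)
  desc-rank (jump {i} i≤ p q d) with desc-rank d
  ... | inj₁ lt = inj₁ (subst (_ <_) (rank-≈ (inj₂ (i , i≤ , q , p))) lt)
  ... | inj₂ e = inj₂ (≈-trans (inj₂ (i , i≤ , p , q)) e)
  desc-rank (down _ _ lt d) with desc-rank d
  ... | inj₁ lt′ = inj₁ (<-trans lt′ lt)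
  ... | inj₂ e = inj₁ (subst (_< _) (rank-≈ e) lt)

  -- A jump need not be an edge, so the whole segment is included to stay connected; its vertices
  -- still lie between `x` and `y` in the order.
  desc-link : ∀ {x y} → x ∈ Z → Desc x y → Σ[ L ∈ List (V Γ) ] Conn (_∈ L) × L ⊆ Z ×
    x ∈ L × y ∈ L × (∀ {v} → v ∈ L → Desc x v × Desc v y)
  desc-link {x} x∈ stop = x ∷ [] , (λ { (here refl) (here refl) → here (here refl) }) ,
    (λ { (here refl) → x∈ }) , here refl , here refl , λ { (here refl) → stop , stop }
  desc-link x∈ (jump {i} i≤ p q d) with desc-link (seg⊆ i≤ q) d
  ... | L , conn , L⊆ , x′∈ , y∈ , between =
    seg i ++ L , conn-++ (seg-conn i) conn q x′∈ , [ seg⊆ i≤ , L⊆ ]′ ∘ ∈-++⁻ (seg i) ,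
    ∈-++⁺ˡ p , ∈-++⁺ʳ (seg i) y∈ , λ v∈ → case ∈-++⁻ (seg i) v∈ of λ
      { (inj₁ s) → jump i≤ p s stop , jump i≤ s q d
      ; (inj₂ l) → let up , dn = between l in jump i≤ p q up , dn }
  desc-link {x} x∈ d₀@(down e z∈ lt d) with desc-link z∈ d
  ... | L , conn , L⊆ , z∈L , y∈ , between = x ∷ L ,
    conn-from x (λ { (here refl) → here (here refl)
                   ; (there l) → step (here refl) e (path-map there (conn z∈L l)) }) ,
    (λ { (here refl) → x∈ ; (there l) → L⊆ l }) , here refl , there y∈ , λ
      { (here refl) → stop , d₀
      ; (there l) → let up , dn = between l in down e z∈ lt up , dn }

  Anc : ℕ → ℕ → Set ℓ
  Anc i j = Σ[ x ∈ V Γ ] Σ[ y ∈ V Γ ] x ∈ seg j × y ∈ seg i × Desc x y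

  seg-≈ : ∀ {i j x y} → i ≤ t → j ≤ t → x ∈ seg i → y ∈ seg j → x ≈ y → i ≡ j
  seg-≈ i≤ j≤ p q (inj₁ refl) = seg-disj i≤ j≤ p q
  seg-≈ i≤ j≤ p q (inj₂ (l , l≤ , r , s)) = trans (seg-disj i≤ l≤ p r) (seg-disj l≤ j≤ s q)

  anc-antisym : ∀ {i j} → i ≤ t → j ≤ t → Anc i j → Anc j i → i ≡ j
  anc-antisym {i} {j} i≤ j≤ (x , y , p , q , d) (y′ , x′ , q′ , p′ , d′) with desc-rank d | desc-rank d′
  ... | inj₂ e | _ = sym (seg-≈ j≤ i≤ p q e)
  ... | _ | inj₂ e = seg-≈ i≤ j≤ q′ p′ e
  ... | inj₁ lt | inj₁ lt′ = ⊥-elim (<-asym lt (subst₂ _<_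
    (rank-≈ (inj₂ (j , j≤ , p′ , p))) (rank-≈ (inj₂ (i , i≤ , q′ , q))) lt′))

  Link : ℕ → ℕ → (ℕ → Set ℓ) → Set ℓ
  Link a b Hit = Σ[ L ∈ List (V Γ) ] Conn (_∈ L) × L ⊆ Z ×
    (Σ[ x ∈ V Γ ] x ∈ L × x ∈ seg a) × (Σ[ y ∈ V Γ ] y ∈ L × y ∈ seg b) ×
    (∀ {c v} → v ∈ L → v ∈ seg c → Hit c)

  -- For comparable segments: the descent from one to the other meets only segments between them.
  chain-link : ∀ {i j} → j ≤ t → Anc i j → Link i j (λ c → Anc i c × Anc c j)
  chain-link j≤ (x , y , p , q , d) =
    let L , conn , L⊆ , x∈ , y∈ , between = desc-link (seg⊆ j≤ p) d
    in L , conn , L⊆ , (y , y∈ , q) , (x , x∈ , p) ,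
       λ v∈ s → let up , dn = between v∈ in (_ , _ , s , q , dn) , (_ , _ , p , s , up)

  -- For incomparable segments: descend from both to the root, meeting only ancestors, hence no
  -- other member of an antichain.
  root-link : ∀ {a b} → a ≤ t → b ≤ t → Link a b (λ c → Anc c a ⊎ Anc c b)
  root-link {a} {b} a≤ b≤ =
    let x , p = seg-inh a ; y , q = seg-inh b
        L , conn , L⊆ , x∈ , r∈ , between = desc-link (seg⊆ a≤ p) (desc-root (seg⊆ a≤ p))
        K , conn′ , K⊆ , y∈ , r∈′ , between′ = desc-link (seg⊆ b≤ q) (desc-root (seg⊆ b≤ q))
    in L ++ K , conn-++ conn conn′ r∈ r∈′ , [ L⊆ , K⊆ ]′ ∘ ∈-++⁻ L ,
       (x , ∈-++⁺ˡ x∈ , p) , (y , ∈-++⁺ʳ L y∈ , q) , λ v∈ s → case ∈-++⁻ L v∈ of λ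
         { (inj₁ l) → inj₁ (_ , _ , p , s , proj₁ (between l))
         ; (inj₂ k) → inj₂ (_ , _ , q , s , proj₁ (between′ k)) }

-- Infinite Ramsey theorem

record Incr : Set where
  constructor incr
  field
    fun  : ℕ → ℕ
    rise : ∀ n → fun n < fun (suc n)

  mono< : ∀ {i j} → i < j → fun i < fun j
  mono< {j = suc j} (s≤s i≤j) with m≤n⇒m<n∨m≡n i≤j
  ... | inj₁ i<j = <-trans (mono< i<j) (rise j)
  ... | inj₂ refl = rise j

  mono≤ : ∀ {i j} → i ≤ j → fun i ≤ fun j
  mono≤ i≤j with m≤n⇒m<n∨m≡n i≤j
  ... | inj₁ i<j = <⇒≤ (mono< i<j)
  ... | inj₂ refl = ≤-refl

  n≤fun : ∀ n → n ≤ fun n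
  n≤fun zero = z≤n
  n≤fun (suc n) = ≤-<-trans (n≤fun n) (rise n)

open Incr

infixr 9 _∘ᵢ_

_∘ᵢ_ : Incr → Incr → Incr
f ∘ᵢ g = incr (fun f ∘ fun g) (λ n → mono< f (rise g n))

module Ramsey (em : ∀ {ℓ} → ExcludedMiddle ℓ) where
  open Classical em

  abstract
    decide : ∀ {p} (P : ℕ → Set p) → Σ[ g ∈ Incr ] ((∀ n → P (fun g n)) ⊎ (∀ n → ¬ P (fun g n)))
    decide P with dec (∀ n → Σ[ m ∈ ℕ ] n ≤ m × P m)
    ... | yes inf = incr g (λ n → proj₁ (proj₂ (inf (suc (g n))))) , inj₁ holds
      where
      g : ℕ → ℕ
      g zero = proj₁ (inf 0)
      g (suc n) = proj₁ (inf (suc (g n)))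
      holds : ∀ n → P (g n)
      holds zero = proj₂ (proj₂ (inf 0))
      holds (suc n) = proj₂ (proj₂ (inf (suc (g n))))
    ... | no fin = let n₀ , none = ¬∀⇒∃¬ fin in
      incr (λ n → n₀ + n) (λ n → ≤-reflexive (sym (+-suc n₀ n))) ,
      inj₂ λ n p → none (n₀ + n , m≤m+n n₀ n , p)

    -- The diagonal of nested subsequences, the step from `F n` to `F (suc n)` deciding `Q n`
    -- against the first term. If `Q` ignores its second argument, this stabilises countably many
    -- properties at once; if it ignores the first, it is the main step of Ramsey's theorem.
    homogenise : ∀ {p} (Q : ℕ → ℕ → ℕ → Set p) → Σ[ g ∈ Incr ]
      (∀ m → (∀ {n} → m < n → Q m (fun g m) (fun g n)) ⊎ (∀ {n} → m < n → ¬ Q m (fun g m) (fun g n)))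
    homogenise Q = incr g rises , homogeneous
      where
      later : Incr
      later = incr suc (λ _ → ≤-refl)
      choice : ∀ n f → Σ[ h ∈ Incr ]
        ((∀ x → Q n (fun f 0) (fun f (suc (fun h x)))) ⊎ (∀ x → ¬ Q n (fun f 0) (fun f (suc (fun h x)))))
      choice n f = decide (λ x → Q n (fun f 0) (fun f (suc x)))
      F : ℕ → Incr
      F zero = incr id (λ _ → ≤-refl)
      F (suc n) = F n ∘ᵢ later ∘ᵢ proj₁ (choice n (F n))
      g : ℕ → ℕ
      g n = fun (F n) 0
      rises : ∀ n → g n < g (suc n)
      rises n = mono< (F n) (s≤s z≤n)
      factor : ∀ {m n} → m ≤ n → ∀ x → Σ[ y ∈ ℕ ] fun (F n) x ≡ fun (F m) y
      factor m≤n x with m≤n⇒m<n∨m≡n m≤n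
      factor {n = suc n} _ x | inj₁ (s≤s m≤n) = factor m≤n _
      ... | inj₂ refl = x , refl
      homogeneous : ∀ m → (∀ {n} → m < n → Q m (g m) (g n)) ⊎ (∀ {n} → m < n → ¬ Q m (g m) (g n))
      homogeneous m with proj₂ (choice m (F m))
      ... | inj₁ all = inj₁ λ m<n → let y , eq = factor m<n 0 in subst (Q m (g m)) (sym eq) (all y)
      ... | inj₂ none = inj₂ λ m<n q → let y , eq = factor m<n 0 in none y (subst (Q m (g m)) eq q)

    ramsey : ∀ {p} (R : ℕ → ℕ → Set p) → Σ[ g ∈ Incr ]
      ((∀ {i j} → i < j → R (fun g i) (fun g j)) ⊎ (∀ {i j} → i < j → ¬ R (fun g i) (fun g j)))
    ramsey R with homogenise (λ _ → R)
    ... | g , colour with decide (λ m → ∀ {n} → m < n → R (fun g m) (fun g n))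
    ...   | h , inj₁ all = g ∘ᵢ h , inj₁ λ {i} i<j → all i (mono< h i<j)
    ...   | h , inj₂ none = g ∘ᵢ h , inj₂ λ {i} i<j → case colour (fun h i) of λ
      { (inj₁ all) → ⊥-elim (none i all)
      ; (inj₂ no-edge) → no-edge (mono< h i<j) }

upto-bound : ∀ {p} (P : ℕ → ℕ → Set p) → (∀ i → Σ[ N ∈ ℕ ] (∀ {m} → N ≤ m → P i m)) →
  ∀ u → Σ[ N ∈ ℕ ] (∀ {i m} → i ≤ u → N ≤ m → P i m)
upto-bound P ex u =
  let N , all = fin-bound {k = suc u} (λ i → P (toℕ i)) (λ i → ex (toℕ i)) in
  N , λ {i} i≤u N≤ → subst (λ j → P j _) (Finₚ.toℕ-fromℕ< (s≤s i≤u)) (all (fromℕ< (s≤s i≤u)) N≤)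

-- Selecting strands and links between consecutive ones

module Strands (em : ∀ {ℓ} → ExcludedMiddle ℓ) {ℓ} (Γ : Graph ℓ) (T : Tower Γ) where

  open Classical em
  open Ramsey em
  open Paths Γ
  open Tower T

  module Zone (t : ℕ) =
    ZoneOrder em Γ t (Z t) (Z-conn t) (seg t) (seg⊆ {t}) (seg-inh t) (seg-conn t) (seg-disj {t})

  open Zone using (Anc)

  IsPair : (ℕ → ℕ → Set ℓ) → ℕ → Set ℓ
  IsPair R m = R (proj₁ (unpair m)) (proj₂ (unpair m))

  -- Thins out the zones so that, for every pair coded by `m`, the relation `Anc` is eventually
  -- constant.
  stabilised = homogenise (λ m _ t → IsPair (Anc t) m)

  times : Incr
  times = proj₁ stabilised

  EventuallyAnc : ℕ → ℕ → Set ℓ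
  EventuallyAnc i j = Σ[ N ∈ ℕ ] (∀ {n} → N ≤ n → Anc (fun times n) i j)

  stable : ∀ i j → EventuallyAnc i j ⊎ (Σ[ N ∈ ℕ ] (∀ {n} → N ≤ n → ¬ Anc (fun times n) i j))
  stable i j with proj₂ stabilised (pair i j)
  ... | inj₁ all = inj₁ (suc (pair i j) , λ {n} N≤ →
    subst (λ p → Anc (fun times n) (proj₁ p) (proj₂ p)) (unpair-pair i j) (all N≤))
  ... | inj₂ none = inj₂ (suc (pair i j) , λ {n} N≤ anc →
    none N≤ (subst (λ p → Anc (fun times n) (proj₁ p) (proj₂ p)) (sym (unpair-pair i j)) anc))

  never : ∀ {i j} → ¬ EventuallyAnc i j → Σ[ N ∈ ℕ ] (∀ {n} → N ≤ n → ¬ Anc (fun times n) i j)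
  never {i} {j} ¬ev with stable i j
  ... | inj₁ ev = ⊥-elim (¬ev ev)
  ... | inj₂ no-anc = no-anc

  -- Two applications of Ramsey leave an ascending chain, a descending chain or an antichain.
  ascending = ramsey EventuallyAnc
  descending = ramsey (λ i j → EventuallyAnc (fun (proj₁ ascending) j) (fun (proj₁ ascending) i))

  strands : Incr
  strands = proj₁ ascending ∘ᵢ proj₁ descending

  k : ℕ → ℕ
  k = fun strands

  k-inj : ∀ {i j} → k i ≡ k j → i ≡ j
  k-inj {i} {j} eq with <-cmp i j
  ... | tri< i<j _ _ = ⊥-elim (<⇒≢ (mono< strands i<j) eq)
  ... | tri≈ _ i≡j _ = i≡j
  ... | tri> _ _ j<i = ⊥-elim (<⇒≢ (mono< strands j<i) (sym eq))

  Homogeneous : (ℕ → ℕ → ℕ → Set ℓ) → Set ℓ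
  Homogeneous P = ∀ {i j} → i < j → Σ[ N ∈ ℕ ] (∀ {n} → N ≤ n → P i j n)

  uniformly : ∀ {P} → Homogeneous P →
    ∀ u → Σ[ N ∈ ℕ ] (∀ {n} → N ≤ n → ∀ {i j} → i < j → j ≤ u → P i j n)
  uniformly {P} hom u =
    let N , all = upto-bound (λ i n → ∀ {j} → j ≤ u → i < j → P i j n) (λ i →
          let M , all′ = upto-bound (λ j n → i < j → P i j n) (bound i) u
          in M , λ M≤ j≤ i<j → all′ j≤ M≤ i<j) u
    in N , λ N≤ i<j j≤ → all (≤-trans (<⇒≤ i<j) j≤) N≤ j≤ i<j
    where
    bound : ∀ i j → Σ[ N ∈ ℕ ] (∀ {n} → N ≤ n → i < j → P i j n)
    bound i j with dec (i < j)
    ... | yes i<j = let N , p = hom i<j in N , λ N≤ _ → p N≤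
    ... | no i≮j = 0 , λ _ i<j → ⊥-elim (i≮j i<j)

  data Type (u n : ℕ) : Set ℓ where
    up   : (∀ {i j} → i < j → j ≤ u → Anc (fun times n) (k i) (k j)) → Type u n
    down : (∀ {i j} → i < j → j ≤ u → Anc (fun times n) (k j) (k i)) → Type u n
    anti : (∀ {i j} → i < j → j ≤ u →
      ¬ Anc (fun times n) (k i) (k j) × ¬ Anc (fun times n) (k j) (k i)) → Type u n

  eventual-type : ∀ u → Σ[ N ∈ ℕ ] (∀ {n} → N ≤ n → Type u n)
  eventual-type u with proj₂ ascending | proj₂ descending
  ... | inj₁ asc | _ =
    let N , all = uniformly (λ i<j → asc (mono< (proj₁ descending) i<j)) u
    in N , λ N≤ → up (all N≤)
  ... | inj₂ _ | inj₁ desc =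
    let N , all = uniformly desc u in N , λ N≤ → down (all N≤)
  ... | inj₂ ¬asc | inj₂ ¬desc =
    let N , all = uniformly (λ i<j →
          let M , p = never (¬asc (mono< (proj₁ descending) i<j)) ; M′ , p′ = never (¬desc i<j)
          in max M M′ , λ le → p (≤-trans (m≤m⊔n M M′) le) , p′ (≤-trans (m≤n⊔m M M′) le)) u
    in N , λ N≤ → anti (all N≤)

  -- Only the strands up to `u` are avoided; later strands may be hit, and `u` grows with time.
  LinkAt : ℕ → ℕ → ℕ → Set ℓ
  LinkAt t u m = Σ[ L ∈ List (V Γ) ] Conn (_∈ L) × L ⊆ Z t ×
    (Σ[ x ∈ V Γ ] x ∈ L × x ∈ seg t (k m)) × (Σ[ y ∈ V Γ ] y ∈ L × y ∈ seg t (k (suc m))) ×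
    (∀ {j v} → j ≤ u → v ∈ L → v ∈ seg t (k j) → j ≡ m ⊎ j ≡ suc m)

  -- In a chain, antisymmetry excludes strands outside the interval from `m` to `suc m`; in an
  -- antichain, no other strand is an ancestor of either end. `alive` makes all strands concerned
  -- present in the zone.
  typed-link : ∀ {u n m} → k u ≤ fun times n → m < u → Type u n → LinkAt (fun times n) u m
  typed-link {u} {n} {m} alive m<u = go
    where
    open Zone (fun times n) using (chain-link; root-link; anc-antisym)
    le : ∀ {j} → j ≤ u → k j ≤ fun times n
    le j≤u = ≤-trans (mono≤ strands j≤u) alive
    m≤u = <⇒≤ m<u
    clash : ∀ {i j} → i ≤ u → j ≤ u → i < j → Anc (fun times n) (k i) (k j) →
      ¬ Anc (fun times n) (k j) (k i)
    clash i≤ j≤ i<j p q = <⇒≢ (mono< strands i<j) (anc-antisym (le i≤) (le j≤) p q)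
    only : ∀ {j} → j ≤ u → (j < m → ⊥) → (suc m < j → ⊥) → j ≡ m ⊎ j ≡ suc m
    only {j} j≤ below above with <-cmp j m
    ... | tri< lt _ _ = ⊥-elim (below lt)
    ... | tri≈ _ eq _ = inj₁ eq
    ... | tri> _ _ gt = inj₂ (≤-antisym (≮⇒≥ above) gt)
    go : Type u n → LinkAt (fun times n) u m
    go (up asc) =
      let L , conn , L⊆ , hitx , hity , between = chain-link (le m<u) (asc ≤-refl m<u)
      in L , conn , L⊆ , hitx , hity , λ j≤ v∈ s → let p , q = between v∈ s in
        only j≤ (λ lt → clash j≤ m≤u lt (asc lt m≤u) p) (λ gt → clash m<u j≤ gt (asc gt j≤) q)
    go (down desc) =
      let L , conn , L⊆ , hity , hitx , between = chain-link (le m≤u) (desc ≤-refl m<u)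
      in L , conn , L⊆ , hitx , hity , λ j≤ v∈ s → let p , q = between v∈ s in
        only j≤ (λ lt → clash j≤ m≤u lt q (desc lt m≤u)) (λ gt → clash m<u j≤ gt p (desc gt j≤))
    go (anti none) =
      let L , conn , L⊆ , hitx , hity , between = root-link (le m≤u) (le m<u)
      in L , conn , L⊆ , hitx , hity , λ {j} j≤ v∈ s →
        only j≤
          (λ lt → [ proj₁ (none lt m≤u) , proj₁ (none (<-trans lt ≤-refl) m<u) ]′ (between v∈ s))
          (λ gt → [ proj₂ (none (<-trans ≤-refl gt) j≤) , proj₂ (none gt j≤) ]′ (between v∈ s))

  links : ∀ u m N → m < u → Σ[ t ∈ ℕ ] N ≤ t × LinkAt t u m
  links u m N m<u =
    let M , types = eventual-type u
        n = max M (max N (k u))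
        n≤ = n≤fun times n
    in fun times n , ≤-trans (≤-trans (m≤m⊔n N (k u)) (m≤n⊔m M _)) n≤ ,
       typed-link (≤-trans (≤-trans (m≤n⊔m N (k u)) (m≤n⊔m M _)) n≤) m<u (types (m≤m⊔n M _))

-- Cells of the quadrant in a tower

module TowerCells (em : ∀ {ℓ} → ExcludedMiddle ℓ) {ℓ} (Γ : Graph ℓ) (T : Tower Γ) where

  open Classical em
  open Paths Γ
  open Tower T
  open Strands em Γ T using (k; k-inj; strands; LinkAt; links)

  k-mono : ∀ {i j} → i ≤ j → k i ≤ k j
  k-mono = mono≤ strands

  Bridge : ℕ → ℕ → ℕ → Set ℓ
  Bridge t u m = Σ[ L ∈ List (V Γ) ] Conn (_∈ L) × L ⊆ Z t ×
    (Σ[ x ∈ V Γ ] x ∈ L × x ∈ seg t (k m)) ×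
    (Σ[ x ∈ V Γ ] Σ[ y ∈ V Γ ] x ∈ L × y ∈ seg t (k (suc m)) × Adj Γ x y) ×
    (∀ {j v} → j ≤ u → v ∈ L → v ∈ seg t (k j) → j ≡ m)

  -- Stop the link just before it first enters strand `suc m`; it then meets strand `m` alone and
  -- can join a cell of that strand.
  bridge : ∀ {t u m} → k u ≤ t → m < u → LinkAt t u m → Bridge t u m
  bridge {t} {u} {m} alive m<u (L , conn , L⊆ , (x , x∈ , xs) , (y , y∈ , ys) , only)
    with first-hit em (_∈ seg t (k (suc m))) (conn x∈ y∈) x∉ ys
    where
    x∉ : x ∉ seg t (k (suc m))
    x∉ xs′ = 1+n≢n (sym (k-inj (seg-disj
      (≤-trans (k-mono (<⇒≤ m<u)) alive) (≤-trans (k-mono m<u) alive) xs xs′)))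
  ... | a , b , ps , e , _ , bs =
    verts ps , verts-conn ps , (λ i → L⊆ (proj₁ (verts-all ps i))) , (x , source∈ ps , xs) ,
    (a , b , target∈ ps , bs , e) , λ j≤ v∈ s → case only j≤ (proj₁ (verts-all ps v∈)) s of λ
      { (inj₁ eq) → eq
      ; (inj₂ refl) → ⊥-elim (proj₂ (verts-all ps v∈) s) }

  bridges : ∀ u m N → m < u → Σ[ t ∈ ℕ ] N ≤ t × Bridge t u m
  bridges u m N m<u = let t , le , link = links u m (max N (k u)) m<u in
    t , ≤-trans (m≤m⊔n N (k u)) le , bridge (≤-trans (m≤n⊔m N (k u)) le) m<u link

  -- The m-th bridge time of block u, counted from time N; only m < u is meaningful.
  bridge-time : ℕ → ℕ → ℕ → ℕ
  from-time : ℕ → ℕ → ℕ → ℕ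
  choose : ∀ u m N → Dec (m < u) → ℕ

  choose u m N (yes m<u) = proj₁ (bridges u m N m<u)
  choose u m N (no _) = N
  from-time N u zero = N
  from-time N u (suc m) = suc (bridge-time N u m)
  bridge-time N u m = choose u m (from-time N u m) (suc m ≤? u)

  choose-≥ : ∀ u m N d → N ≤ choose u m N d
  choose-≥ u m N (yes m<u) = proj₁ (proj₂ (bridges u m N m<u))
  choose-≥ u m N (no _) = ≤-refl

  choose-bridge : ∀ u m N d → m < u → Bridge (choose u m N d) u m
  choose-bridge u m N (yes m<u) _ = proj₂ (proj₂ (bridges u m N m<u))
  choose-bridge u m N (no m≮u) m<u = ⊥-elim (m≮u m<u)

  bridge-time-≥ : ∀ N u m → from-time N u m ≤ bridge-time N u m
  bridge-time-≥ N u m = choose-≥ u m (from-time N u m) (suc m ≤? u)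

  bridge-time-mono : ∀ N u {m n} → m < n → bridge-time N u m < bridge-time N u n
  bridge-time-mono N u {m} {suc n} (s≤s m≤n) with m≤n⇒m<n∨m≡n m≤n
  ... | inj₁ m<n = <-trans (bridge-time-mono N u m<n) (bridge-time-≥ N u (suc n))
  ... | inj₂ refl = bridge-time-≥ N u (suc n)

  begin : ℕ → ℕ
  begin zero = k 0
  -- Entry `m = u` of block `u` carries no bridge and defaults to a time after all its bridges; the
  -- second term of `max` makes strand `suc u` present.
  begin (suc u) = max (suc (bridge-time (begin u) u u)) (k (suc u))

  τ : ℕ → ℕ → ℕ
  τ u = bridge-time (begin u) u

  τ-≥ : ∀ u m → begin u ≤ τ u m
  τ-≥ u zero = bridge-time-≥ (begin u) u 0
  τ-≥ u (suc m) = ≤-trans (τ-≥ u m) (<⇒≤ (bridge-time-≥ (begin u) u (suc m)))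

  τ-< : ∀ {u m} → m ≤ u → τ u m < begin (suc u)
  τ-< {u} {m} m≤u = ≤-trans (s≤s τ≤) (m≤m⊔n _ (k (suc u)))
    where
    τ≤ : τ u m ≤ τ u u
    τ≤ with m≤n⇒m<n∨m≡n m≤u
    ... | inj₁ m<u = <⇒≤ (bridge-time-mono (begin u) u m<u)
    ... | inj₂ refl = ≤-refl

  begin-incr : Incr
  begin-incr = incr begin (λ u → ≤-<-trans (τ-≥ u 0) (τ-< z≤n))

  begin-mono : ∀ {u v} → u ≤ v → begin u ≤ begin v
  begin-mono = mono≤ begin-incr

  k≤begin : ∀ {j u} → j ≤ u → k j ≤ begin u
  k≤begin {u = zero} z≤n = ≤-refl
  k≤begin {u = suc u} j≤ = ≤-trans (k-mono j≤) (m≤n⊔m _ (k (suc u)))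

  block-unique : ∀ {u v t} → begin u ≤ t → t < begin (suc u) → begin v ≤ t → t < begin (suc v) → u ≡ v
  block-unique {u} {v} l r l′ r′ with <-cmp u v
  ... | tri< u<v _ _ = ⊥-elim (<⇒≱ r (≤-trans (begin-mono u<v) l′))
  ... | tri≈ _ eq _ = eq
  ... | tri> _ _ v<u = ⊥-elim (<⇒≱ r′ (≤-trans (begin-mono v<u) l))

  τ-inj : ∀ {u m v n} → m ≤ u → n ≤ v → τ u m ≡ τ v n → u ≡ v × m ≡ n
  τ-inj {u} {m} {v} {n} m≤u n≤v eq
    with block-unique {u} {v} (τ-≥ u m) (τ-< m≤u) (subst (begin v ≤_) (sym eq) (τ-≥ v n))
           (subst (_< begin (suc v)) (sym eq) (τ-< n≤v))
  ... | refl with <-cmp m n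
  ...   | tri< m<n _ _ = ⊥-elim (<⇒≢ (bridge-time-mono (begin u) u m<n) eq)
  ...   | tri≈ _ m≡n _ = refl , m≡n
  ...   | tri> _ _ n<m = ⊥-elim (<⇒≢ (bridge-time-mono (begin u) u n<m) (sym eq))

  τ-bridge : ∀ {u m} → m < u → Bridge (τ u m) u m
  τ-bridge {u} {m} m<u = choose-bridge u m (from-time (begin u) u m) (suc m ≤? u) m<u

  -- Cell (a , b) occupies the strand k a during the blocks index a b and index a b + 1; the latter is
  -- the first block of cell (a + 1 , b), and there a bridge leads from strand k a to k (a + 1).
  index : ℕ → ℕ → ℕ
  index a zero = a
  index a (suc b) = suc (suc (index a b))

  index-suc : ∀ a b → index (suc a) b ≡ suc (index a b)
  index-suc a zero = refl
  index-suc a (suc b) = cong (λ i → suc (suc i)) (index-suc a b)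

  index-≥ : ∀ a b → a ≤ index a b
  index-≥ a zero = ≤-refl
  index-≥ a (suc b) = ≤-trans (index-≥ a b) (≤-trans (n≤1+n _) (n≤1+n _))

  index-mono : ∀ a {b d} → b < d → suc (suc (index a b)) ≤ index a d
  index-mono a {b} {suc d} (s≤s b≤d) with m≤n⇒m<n∨m≡n b≤d
  ... | inj₁ b<d = ≤-trans (index-mono a b<d) (≤-trans (n≤1+n _) (n≤1+n _))
  ... | inj₂ refl = ≤-refl

  lo hi : ℕ → ℕ → ℕ
  lo a b = begin (index a b)
  hi a b = begin (suc (suc (index a b)))

  time : ℕ → ℕ → ℕ
  time a b = τ (suc (index a b)) a

  Br : ∀ a b → Bridge (time a b) (suc (index a b)) a
  Br a b = τ-bridge (s≤s (index-≥ a b))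

  Bridge∋ : ℕ → ℕ → VSet
  Bridge∋ a b x = x ∈ proj₁ (Br a b)

  bridge-Z : ∀ {a b x} → Bridge∋ a b x → x ∈ Z (time a b)
  bridge-Z {a} {b} = proj₁ (proj₂ (proj₂ (Br a b)))

  Strand : ℕ → ℕ → VSet
  Strand a b x = Σ[ t ∈ ℕ ] lo a b ≤ t × t < hi a b × x ∈ seg t (k a)

  time-≥ : ∀ a b → begin (suc (index a b)) ≤ time a b
  time-≥ a b = τ-≥ (suc (index a b)) a

  time-< : ∀ a b → time a b < hi a b
  time-< a b = τ-< (≤-trans (index-≥ a b) (n≤1+n _))

  lo≤time : ∀ a b → lo a b ≤ time a b
  lo≤time a b = ≤-trans (begin-mono (n≤1+n _)) (time-≥ a b)

  Cell : ℕ → ℕ → VSet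
  Cell a b x = Strand a b x ⊎ Bridge∋ a b x

  alive : ∀ {a b t} → lo a b ≤ t → k a ≤ t
  alive {a} {b} le = ≤-trans (k≤begin (index-≥ a b)) le

  base : ∀ a b → V Γ
  base a b = proj₁ (seg-inh (lo a b) (k a))

  base∈ : ∀ a b → Strand a b (base a b)
  base∈ a b = lo a b , ≤-refl , mono< begin-incr (n≤1+n _) , proj₂ (seg-inh (lo a b) (k a))

  within : ∀ {a b t x y} → lo a b ≤ t → t < hi a b → x ∈ seg t (k a) → y ∈ seg t (k a) →
    PathIn Γ (Strand a b) x y
  within {t = t} l h p q = path-map (λ s → t , l , h , s) (seg-conn t _ p q)

  strand-conn : ∀ a b → Conn (Strand a b)
  strand-conn a b = conn-from (base a b) λ { (t , l , h , s) → from-base t l h s }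
    where
    from-base : ∀ t {x} → lo a b ≤ t → t < hi a b → x ∈ seg t (k a) → PathIn Γ (Strand a b) (base a b) x
    from-base t l h s with m≤n⇒m<n∨m≡n l
    ... | inj₂ refl = within l h (proj₂ (seg-inh (lo a b) (k a))) s
    from-base (suc t) l h s | inj₁ (s≤s l′) =
      let x , y , xs , ys , e = seg-next (alive {a} {b} l′) ; h′ = <-trans ≤-refl h
      in from-base t l′ h′ xs ⊕ edge (t , l′ , h′ , xs) e (suc t , l , h , ys) ⊕ within l h ys s

  cell-conn : ∀ a b → Conn (Cell a b)
  cell-conn a b =
    let _ , conn , _ , (x , x∈ , xs) , _ = Br a b
    in conn-∪ (strand-conn a b) conn (time a b , lo≤time a b , time-< a b , xs) x∈ id inj₁ inj₂

  same-zone : ∀ {s t x} → x ∈ Z s → x ∈ Z t → s ≡ t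
  same-zone {s} {t} p q with <-cmp s t
  ... | tri< s<t _ _ = ⊥-elim (Z-disj s<t p q)
  ... | tri≈ _ eq _ = eq
  ... | tri> _ _ t<s = ⊥-elim (Z-disj t<s q p)

  same-span : ∀ {a b d t} → lo a b ≤ t → t < hi a b → lo a d ≤ t → t < hi a d → b ≡ d
  same-span {a} {b} {d} l h l′ h′ with <-cmp b d
  ... | tri< b<d _ _ = ⊥-elim (<⇒≱ h (≤-trans (begin-mono (index-mono a b<d)) l′))
  ... | tri≈ _ eq _ = eq
  ... | tri> _ _ d<b = ⊥-elim (<⇒≱ h′ (≤-trans (begin-mono (index-mono a d<b)) l))

  strand-Z : ∀ {a b t x} → lo a b ≤ t → x ∈ seg t (k a) → x ∈ Z t
  strand-Z {a} {b} l = seg⊆ (alive {a} {b} l)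

  strand-strand : ∀ {a b c d x} → Strand a b x → Strand c d x → (a , b) ≡ (c , d)
  strand-strand {a} {b} {c} {d} (t , l , h , s) (t′ , l′ , h′ , s′)
    with same-zone (strand-Z {a} {b} l s) (strand-Z {c} {d} l′ s′)
  ... | refl with k-inj (seg-disj (alive {a} {b} l) (alive {c} {d} l′) s s′)
  ...   | refl = cong (a ,_) (same-span {a} l h l′ h′)

  -- At the time of the bridge the current block is `suc (index a b)`, and a strand occupied by a
  -- cell then has number at most that. So it is among the strands that the bridge avoids, unless it
  -- is strand `a`.
  strand-bridge : ∀ {a b c d x} → Strand c d x → Bridge∋ a b x → (a , b) ≡ (c , d)
  strand-bridge {a} {b} {c} {d} (t , l , h , s) p
    with same-zone (bridge-Z {a} {b} p) (strand-Z {c} {d} l s)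
  ... | refl with proj₂ (proj₂ (proj₂ (proj₂ (proj₂ (Br a b))))) c≤ p s
    where
    c≤ : c ≤ suc (index a b)
    c≤ = ≤-trans (index-≥ c d) (≮⇒≥ λ lt →
      <⇒≱ (time-< a b) (≤-trans (begin-mono lt) l))
  ... | refl = cong (a ,_) (same-span {a} (lo≤time a b) (time-< a b) l h)

  index-inj : ∀ a {b d} → index a b ≡ index a d → b ≡ d
  index-inj a {b} {d} eq with <-cmp b d
  ... | tri< b<d _ _ = ⊥-elim (<⇒≢ (≤-trans (n≤1+n _) (index-mono a b<d)) eq)
  ... | tri≈ _ e _ = e
  ... | tri> _ _ d<b = ⊥-elim (<⇒≢ (≤-trans (n≤1+n _) (index-mono a d<b)) (sym eq))

  -- Different bridges have different times by `τ-inj`, and zones of different times are disjoint.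
  bridge-bridge : ∀ {a b c d x} → Bridge∋ a b x → Bridge∋ c d x → (a , b) ≡ (c , d)
  bridge-bridge {a} {b} {c} {d} p q
    with τ-inj (≤-trans (index-≥ a b) (n≤1+n _)) (≤-trans (index-≥ c d) (n≤1+n _))
           (same-zone (bridge-Z {a} {b} p) (bridge-Z {c} {d} q))
  ... | eq , refl = cong (a ,_) (index-inj a (suc-injective eq))

  cells : QuadrantCells Γ
  cells = record
    { cell = Cell
    ; inhabited = λ a b → base a b , inj₁ (base∈ a b)
    ; connected = cell-conn
    ; disjoint = λ
      { (inj₁ s) (inj₁ s′) → strand-strand s s′
      ; (inj₁ s) (inj₂ p) → sym (strand-bridge s p)
      ; (inj₂ p) (inj₁ s) → strand-bridge s p
      ; (inj₂ p) (inj₂ q) → bridge-bridge p q }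
    ; vertical = vertical
    ; horizontal = horizontal
    }
    where
    vertical : ∀ a b → Σ[ x ∈ V Γ ] Σ[ y ∈ V Γ ] Cell a b x × Cell a (suc b) y × Adj Γ x y
    vertical a b = last (hi a b) refl (proj₁ (proj₂ (proj₂ (base∈ a b))))
      where
      -- Since `lo a b < hi a b`, the bound `hi a b` is a successor; its predecessor is the last
      -- time of this cell, and `hi a b` is the first time of the cell above.
      last : ∀ h → hi a b ≡ h → lo a b < h →
        Σ[ x ∈ V Γ ] Σ[ y ∈ V Γ ] Cell a b x × Cell a (suc b) y × Adj Γ x y
      last (suc t) eq (s≤s l) =
        let x , y , xs , ys , e = seg-next (alive {a} {b} l)
        in x , y , inj₁ (t , l , subst (t <_) (sym eq) ≤-refl , xs) ,
           inj₁ (suc t , ≤-reflexive eq ,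
             subst (_< hi a (suc b)) eq (mono< begin-incr (n≤1+n _)) , ys) , e
    horizontal : ∀ a b → Σ[ x ∈ V Γ ] Σ[ y ∈ V Γ ] Cell a b x × Cell (suc a) b y × Adj Γ x y
    horizontal a b =
      let _ , _ , _ , _ , (x , y , x∈ , ys , e) , _ = Br a b
      in x , y , inj₂ x∈ , inj₁ (time a b ,
           subst (λ i → begin i ≤ time a b) (sym (index-suc a b)) (time-≥ a b) ,
           <-≤-trans (time-< a b) (subst (λ i → begin (suc (suc (index a b))) ≤ begin (suc (suc i)))
             (sym (index-suc a b)) (begin-mono (n≤1+n _))) , ys) , e

-- Composing and restricting minor models

module Models (em : ∀ {ℓ} → ExcludedMiddle ℓ) where
  open Classical em

  module _ {h k} {H : Graph h} {K : Graph k} (M : H ≼ K) where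
    open MinorModel M
    open Paths K

    lift-path : ∀ {P : V H → Set h} {S : V K → Set k} → (∀ {w x} → P w → branch w x → S x) →
      ∀ {u v x y} → PathIn H P u v → branch u x → branch v y → PathIn K S x y
    lift-path inS (here p) bx by = path-map (inS p) (connected _ _ _ bx by)
    -- `edges` serves distinct vertices only, and a step of the path may be a loop.
    lift-path inS {u} (step {z = w} p e ps) bx by with dec (u ≡ w)
    ... | yes refl = lift-path inS ps bx by
    ... | no u≢w with edges u w u≢w e
    ...   | a , b , ba , bb , e′ =
      path-map (inS p) (connected _ _ _ bx ba) ⊕ step (inS p ba) e′ (lift-path inS ps bb by)

  ≼-trans : ∀ {g k} {G : Graph g} {H : Graph Level.zero} {K : Graph k} → G ≼ H → H ≼ K → G ≼ K
  ≼-trans {H = H} M N = record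
    { branch = λ u x → Σ[ w ∈ V H ] M.branch u w × N.branch w x
    ; nonempty = λ u → let w , b = M.nonempty u ; x , c = N.nonempty w in x , w , b , c
    ; connected = λ { u x y (w , b , c) (w′ , b′ , c′) →
        lift-path N (λ b c → _ , b , c) (M.connected u w w′ b b′) c c′ }
    ; disjoint = λ { u v x (w , b , c) (w′ , b′ , c′) → case N.disjoint w w′ x c c′ of λ
        { refl → M.disjoint u v w b b′ } }
    ; edges = λ u v u≢v e →
        let w , w′ , b , b′ , e′ = M.edges u v u≢v e
            x , y , c , c′ , e″ = N.edges w w′
              (λ eq → u≢v (M.disjoint u v w b (subst (M.branch v) (sym eq) b′))) e′
        in x , y , (w , b , c) , (w′ , b′ , c′) , e″ }
    where
    module M = MinorModel M
    module N = MinorModel N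

  restrict : ∀ {g h k} {G : Graph g} {H : Graph h} {K : Graph k} (ι : V G → V H) →
    (∀ {u v} → ι u ≡ ι v → u ≡ v) → (∀ {u v} → Adj G u v → Adj H (ι u) (ι v)) → H ≼ K → G ≼ K
  restrict ι inj hom N = record
    { branch = λ u → branch (ι u)
    ; nonempty = λ u → nonempty (ι u)
    ; connected = λ u → connected (ι u)
    ; disjoint = λ u v x b c → inj (disjoint (ι u) (ι v) x b c)
    ; edges = λ u v u≢v e → edges (ι u) (ι v) (u≢v ∘ inj) (hom e) }
    where open MinorModel N

  infinitely-many : ∀ {g k} {G : Graph g} {K : Graph k} (N : ℕ → G ≼ K) →
    (∀ {i j u v x} → MinorModel.branch (N i) u x → MinorModel.branch (N j) v x → i ≡ j) → ℵ₀· G ≼ K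
  infinitely-many N apart = record
    { branch = λ { (lift i , u) → branch (N i) u }
    ; nonempty = λ { (lift i , u) → nonempty (N i) u }
    ; connected = λ { (lift i , u) → connected (N i) u }
    ; disjoint = λ { (lift i , u) (lift j , v) x b c → case apart b c of λ
        { refl → cong (lift i ,_) (disjoint (N i) u v x b c) } }
    ; edges = λ
      { (lift i , u) (lift j , v) u≢v (inj₁ (refl , e)) →
          edges (N i) u v (u≢v ∘ cong (lift i ,_)) (inj₁ e)
      ; (lift i , u) (lift j , v) u≢v (inj₂ (refl , e)) →
          edges (N i) u v (u≢v ∘ cong (lift i ,_)) (inj₂ e) } }
    where open MinorModel

-- The half grid as a minor of the quadrant

double : ℕ → ℕ
double zero = 0
double (suc n) = suc (suc (double n))

half-double : ∀ n → ⌊ double n /2⌋ ≡ n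
half-double zero = refl
half-double (suc n) = cong suc (half-double n)

double-half : ∀ n → n ≡ double ⌊ n /2⌋ ⊎ n ≡ suc (double ⌊ n /2⌋)
double-half zero = inj₁ refl
double-half (suc zero) = inj₂ refl
double-half (suc (suc n)) with double-half n
... | inj₁ eq = inj₁ (cong (λ m → suc (suc m)) eq)
... | inj₂ eq = inj₂ (cong (λ m → suc (suc m)) eq)

distance-one : ∀ i j → ℤ.∣ i ℤ.- j ∣ ≡ 1 → i ≡ ℤ.suc j ⊎ j ≡ ℤ.suc i
distance-one i j eq = go (i ℤ.- j) refl eq
  where
  restore : ∀ d → i ℤ.- j ≡ d → i ≡ d ℤ.+ j
  restore d refl = sym (trans (ℤₚ.+-assoc i (ℤ.- j) j)
    (trans (cong (ℤ._+_ i) (ℤₚ.+-inverseˡ j)) (ℤₚ.+-identityʳ i)))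
  go : ∀ d → i ℤ.- j ≡ d → ℤ.∣ d ∣ ≡ 1 → i ≡ ℤ.suc j ⊎ j ≡ ℤ.suc i
  go (+ 1) e refl = inj₁ (restore _ e)
  go -[1+ 0 ] e refl = inj₂ (trans (sym (ℤₚ.suc-pred j)) (cong ℤ.suc (sym (restore _ e))))

-- The row n of the half grid is the L-shaped path of all points of the quadrant with minimum n, two
-- consecutive points of that path forming one vertex.
fold : ℕ → ℕ → ℕ × ℤ
fold x zero = 0 , + ⌊ x /2⌋
fold zero (suc y) = 0 , -[1+ ⌊ y /2⌋ ]
fold (suc x) (suc y) = suc (proj₁ (fold x y)) , proj₂ (fold x y)

fold-shift : ∀ n x y → fold (n + x) (n + y) ≡ (n + proj₁ (fold x y) , proj₂ (fold x y))
fold-shift zero x y = refl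
fold-shift (suc n) x y rewrite fold-shift n x y = refl

-- The two points of the fibre over row 0, sorted by their distance from the corner; `shift n` moves
-- them to row `n`.
near far : ℤ → ℕ × ℕ
near (+ m) = double m , 0
near -[1+ m ] = 0 , suc (double m)
far (+ m) = suc (double m) , 0
far -[1+ m ] = 0 , suc (suc (double m))

half-suc-double : ∀ n → ⌊ suc (double n) /2⌋ ≡ n
half-suc-double zero = refl
half-suc-double (suc n) = cong suc (half-suc-double n)

fold-near : ∀ z → fold (proj₁ (near z)) (proj₂ (near z)) ≡ (0 , z)
fold-near (+ m) = cong (λ k → 0 , + k) (half-double m)
fold-near -[1+ m ] = cong (λ k → 0 , -[1+ k ]) (half-double m)

fold-far : ∀ z → fold (proj₁ (far z)) (proj₂ (far z)) ≡ (0 , z)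
fold-far (+ m) = cong (λ k → 0 , + k) (half-suc-double m)
fold-far -[1+ m ] = cong (λ k → 0 , -[1+ k ]) (half-suc-double m)

shift : ℕ → ℕ × ℕ → ℕ × ℕ
shift n (x , y) = n + x , n + y

Fibre : ℕ × ℤ → ℕ × ℕ → Set
Fibre u (x , y) = fold x y ≡ u

shift-fibre : ∀ n {z p} → Fibre (0 , z) p → Fibre (n , z) (shift n p)
shift-fibre n {z} {x , y} eq = trans (fold-shift n x y)
  (trans (cong (λ q → n + proj₁ q , proj₂ q) eq) (cong (_, z) (+-identityʳ n)))

near∈ : ∀ n z → Fibre (n , z) (shift n (near z))
near∈ n z = shift-fibre n {z} {near z} (fold-near z)

far∈ : ∀ n z → Fibre (n , z) (shift n (far z))
far∈ n z = shift-fibre n {z} {far z} (fold-far z)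

fibre-points : ∀ x y → let n , z = fold x y in
  (x , y) ≡ shift n (near z) ⊎ (x , y) ≡ shift n (far z)
fibre-points x zero with double-half x
... | inj₁ eq = inj₁ (cong (_, 0) eq)
... | inj₂ eq = inj₂ (cong (_, 0) eq)
fibre-points zero (suc y) with double-half y
... | inj₁ eq = inj₁ (cong (λ k → 0 , suc k) eq)
... | inj₂ eq = inj₂ (cong (λ k → 0 , suc k) eq)
fibre-points (suc x) (suc y) with fibre-points x y
... | inj₁ eq = inj₁ (cong (shift 1) eq)
... | inj₂ eq = inj₂ (cong (shift 1) eq)

module Quad = Paths Quadrant

near-far : ∀ n z → Adj Quadrant (shift n (near z)) (shift n (far z))
near-far n (+ m) = inj₁ (inj₂ (refl , +-suc n (double m)))
near-far n -[1+ m ] = inj₁ (inj₁ (refl , +-suc n (suc (double m))))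

fibre-conn : ∀ u → Quad.Conn (Fibre u)
fibre-conn (n , z) = Quad.conn-from (shift n (near z)) to-near
  where
  to-near : ∀ {p} → Fibre (n , z) p → PathIn Quadrant (Fibre (n , z)) (shift n (near z)) p
  to-near {x , y} refl with fibre-points x y
  ... | inj₁ eq = subst (PathIn Quadrant _ _) (sym eq) (here (near∈ n z))
  ... | inj₂ eq = subst (PathIn Quadrant _ _) (sym eq) (Quad.edge (near∈ n z) (near-far n z) (far∈ n z))

Crossing : ℕ × ℤ → ℕ × ℤ → Set
Crossing u v = Σ[ p ∈ ℕ × ℕ ] Σ[ q ∈ ℕ × ℕ ] Fibre u p × Fibre v q × Adj Quadrant p q

crossing-sym : ∀ {u v} → Crossing u v → Crossing v u
crossing-sym (p , q , i , j , e) = q , p , j , i , Quad.adj-sym e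

-- The row runs down the negative arm of the L to the corner and out along the positive arm.
along-row : ∀ n z → Crossing (n , z) (n , ℤ.suc z)
along-row n (+ m) = _ , _ , far∈ n (+ m) , near∈ n (+ suc m) ,
  inj₁ (inj₂ (refl , +-suc n (suc (double m))))
along-row n -[1+ 0 ] = _ , _ , near∈ n -[1+ 0 ] , near∈ n (+ 0) , inj₂ (inj₁ (refl , +-suc n 0))
along-row n -[1+ suc m ] = _ , _ , near∈ n -[1+ suc m ] , far∈ n -[1+ m ] ,
  inj₂ (inj₁ (refl , +-suc n (suc (suc (double m)))))

-- Row `suc n` is row `n` moved diagonally by one, which places its near point beside the far point
-- of row `n`.
along-column : ∀ n z → Crossing (n , z) (suc n , z)
along-column n (+ m) = _ , _ , far∈ n (+ m) , near∈ (suc n) (+ m) ,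
  inj₁ (inj₁ (+-suc n (double m) , refl))
along-column n -[1+ m ] = _ , _ , far∈ n -[1+ m ] , near∈ (suc n) -[1+ m ] ,
  inj₁ (inj₂ (+-suc n (suc (double m)) , refl))

crossing : ∀ u v → E HalfGrid u v → Crossing u v
crossing (a , b) (c , d) (inj₁ (refl , dist)) with distance-one b d dist
... | inj₁ refl = crossing-sym (along-row a d)
... | inj₂ refl = along-row a b
crossing (a , b) (c , d) (inj₂ (refl , dist)) with distance-one (+ a) (+ c) dist
... | inj₁ refl = crossing-sym (along-column c b)
... | inj₂ refl = along-column a b

halfgrid≼quadrant : HalfGrid ≼ Quadrant
halfgrid≼quadrant = record
  { branch = Fibre
  ; nonempty = λ { (n , z) → _ , near∈ n z }
  ; connected = λ u x y → fibre-conn u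
  ; disjoint = λ u v x p q → trans (sym p) q
  ; edges = λ { u v _ (inj₁ e) → crossing u v e ; u v _ (inj₂ e) → crossing-sym (crossing v u e) } }

-- Infinitely many disjoint copies in the quadrant

∣n⊖1+n∣ : ∀ n → ℤ.∣ n ℤ.⊖ suc n ∣ ≡ 1
∣n⊖1+n∣ zero = refl
∣n⊖1+n∣ (suc n) = trans (cong ℤ.∣_∣ (ℤₚ.[1+m]⊖[1+n]≡m⊖n n (suc n))) (∣n⊖1+n∣ n)

∣1+n⊖n∣ : ∀ n → ℤ.∣ suc n ℤ.⊖ n ∣ ≡ 1
∣1+n⊖n∣ zero = refl
∣1+n⊖n∣ (suc n) = trans (cong ℤ.∣_∣ (ℤₚ.[1+m]⊖[1+n]≡m⊖n (suc n) n)) (∣1+n⊖n∣ n)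

quadrant⁺ quadrant⁻ : ℕ × ℕ → ℕ × ℤ
quadrant⁺ (a , b) = a , + b
quadrant⁻ (a , b) = a , -[1+ b ]

quadrant⁺-edge : ∀ {u v} → E Quadrant u v → E HalfGrid (quadrant⁺ u) (quadrant⁺ v)
quadrant⁺-edge {a , b} (inj₁ (refl , refl)) = inj₁ (refl , ∣n⊖1+n∣ b)
quadrant⁺-edge {a , b} (inj₂ (refl , refl)) = inj₂ (refl , ∣n⊖1+n∣ a)

quadrant⁻-edge : ∀ {u v} → E Quadrant u v → E HalfGrid (quadrant⁻ u) (quadrant⁻ v)
quadrant⁻-edge {a , b} (inj₁ (refl , refl)) = inj₁ (refl , ∣1+n⊖n∣ (suc b))
quadrant⁻-edge {a , b} (inj₂ (refl , refl)) = inj₂ (refl , ∣n⊖1+n∣ a)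

module Copies (em : ∀ {ℓ} → ExcludedMiddle ℓ) where
  open Models em
  open MinorModel

  on-edges : ∀ {ι : ℕ × ℕ → ℕ × ℤ} → (∀ {u v} → E Quadrant u v → E HalfGrid (ι u) (ι v)) →
    ∀ {u v} → Adj Quadrant u v → Adj HalfGrid (ι u) (ι v)
  on-edges hom (inj₁ e) = inj₁ (hom e)
  on-edges hom (inj₂ e) = inj₂ (hom e)

  left right : Quadrant ≼ Quadrant
  left = restrict quadrant⁺ (λ { refl → refl }) (on-edges quadrant⁺-edge) halfgrid≼quadrant
  right = restrict quadrant⁻ (λ { refl → refl }) (on-edges quadrant⁻-edge) halfgrid≼quadrant

  -- Both quadrants of the half grid contain all of it again.
  nested : ℕ → Quadrant ≼ Quadrant
  nested zero = left
  nested (suc i) = ≼-trans (nested i) right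

  left-right : ∀ {u v x} → branch left u x → ¬ branch right v x
  left-right p q with trans (sym p) q
  ... | ()

  nested-apart : ∀ i j {u v x} → branch (nested i) u x → branch (nested j) v x → i ≡ j
  nested-apart zero zero _ _ = refl
  nested-apart zero (suc j) {u} p (w , _ , r) = ⊥-elim (left-right {u} {w} p r)
  nested-apart (suc i) zero {v = v} (w , _ , r) p = ⊥-elim (left-right {v} {w} p r)
  nested-apart (suc i) (suc j) {x = x} (w , p , r) (w′ , q , r′) with disjoint right w w′ x r r′
  ... | refl = cong suc (nested-apart i j p q)

  from-quadrant : ∀ {g k} {G : Graph g} {K : Graph k} → G ≼ HalfGrid → Quadrant ≼ K → ℵ₀· G ≼ K
  from-quadrant {G = G} {K} M N = infinitely-many copy apart
    where
    inner : ℕ → G ≼ Quadrant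
    inner i = ≼-trans (≼-trans M halfgrid≼quadrant) (nested i)
    copy : ℕ → G ≼ K
    copy i = ≼-trans (inner i) N
    apart : ∀ {i j u v x} → branch (copy i) u x → branch (copy j) v x → i ≡ j
    apart {i} {j} {x = x} (w , (_ , _ , p) , c) (w′ , (_ , _ , q) , c′) with disjoint N w w′ x c c′
    ... | refl = nested-apart i j p q

-- Ubiquity of connected minors of the half grid

module Final (em : ∀ {ℓ} → ExcludedMiddle ℓ) {g k} (G : Graph g) (G-conn : Connected G)
  (Γ : Graph k) where

  open Classical em
  open Models em
  open Paths Γ
  open MinorModel

  -- Excluded middle resizes propositions, so that a union over V G becomes a set of vertices of Γ.
  Resize : ∀ {p} → Set p → Set k
  Resize P with dec P
  ... | yes _ = ⊤
  ... | no _ = Poly.⊥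

  resize : ∀ {p} {P : Set p} → P → Resize P
  resize {P = P} p with dec P
  ... | yes _ = tt
  ... | no ¬p = ⊥-elim (¬p p)

  unresize : ∀ {p} {P : Set p} → Resize P → P
  unresize {P = P} r with dec P
  ... | yes p = p
  unresize () | no _

  -- The instance of `𝒢` to which the concentration argument is applied.
  record Hosts (S : VSet) : Set (g ⊔ lsuc k) where
    field
      conn  : Conn S
      inh   : Σ (V Γ) S
      model : G ≼ Γ
      inS   : ∀ {u x} → branch model u x → S x

  union : G ≼ Γ → VSet
  union M x = Resize (Σ[ u ∈ V G ] branch M u x)

  -- The union of the branch sets is connected because `G` is: paths of `G` lift through the model.
  hosts : (M : G ≼ Γ) → Hosts (union M)
  hosts M = record
    { conn = λ p q → let u , b = unresize p ; v , c = unresize q in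
        lift-path M (λ _ b → resize (_ , b)) (proj₂ G-conn u v) b c
    ; inh = let x , b = nonempty M (proj₁ G-conn) in x , resize (_ , b)
    ; model = M
    ; inS = λ b → resize (_ , b) }

  copy : ∀ {n} → (n · G) ≼ Γ → Fin n → G ≼ Γ
  copy M i = restrict (lift i ,_) (λ { refl → refl })
    (λ { (inj₁ e) → inj₁ (refl , e) ; (inj₂ e) → inj₂ (refl , e) }) M

  fat-top : (∀ n → (n · G) ≼ Γ) → ∀ n → Σ[ Ss ∈ List VSet ] n ≤ length Ss × AllPairs Disj Ss ×
    All (λ S → Hosts S × ⊤ {k}) Ss
  fat-top Ms n = tabulate S , ≤-reflexive (sym (length-tabulate S)) ,
    AllPairsₚ.tabulate⁺ disj , Allₚ.tabulate⁺ (λ i → hosts (copy (Ms n) i) , tt)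
    where
    S : Fin n → VSet
    S i = union (copy (Ms n) i)
    disj : ∀ {i j} → i ≢ j → Disj (S i) (S j)
    disj {i} {j} i≢j {x} p q =
      let u , b = unresize p ; v , c = unresize q
      in i≢j (cong (lower ∘ proj₁) (disjoint (Ms n) (lift i , u) (lift j , v) x b c))

  Packing : Set (g ⊔ lsuc k)
  Packing = Σ[ S ∈ (ℕ → VSet) ] (∀ i → Hosts (S i)) × DisjointSeq S

  packing-copies : Packing → ℵ₀· G ≼ Γ
  packing-copies (S , host , disj) = infinitely-many (λ i → Hosts.model (host i)) λ {i} {j} b c →
    case <-cmp i j of λ
      { (tri< i<j _ _) → ⊥-elim (disj i<j (Hosts.inS (host i) b) (Hosts.inS (host j) c))
      ; (tri≈ _ eq _) → eq
      ; (tri> _ _ j<i) → ⊥-elim (disj j<i (Hosts.inS (host j) c) (Hosts.inS (host i) b)) }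

  quadrant-minor : ¬ Packing → (∀ n → (n · G) ≼ Γ) → QuadrantCells Γ
  quadrant-minor none Ms = at-end (haven (fat-top Ms))
    where
    open Concentration em Γ Hosts Hosts.conn Hosts.inh none using (haven)
    undominated : ∀ {X₀} {H : Haven Γ X₀} →
      (∀ v → v ∉ X₀ → Σ[ X ∈ List (V Γ) ] v ∉ X × ¬ Haven.C H X v) → QuadrantCells Γ
    undominated {H = H} und = TowerCells.cells em Γ
      (BuildTower.tower em Γ H (UndominatedEnd.ray-supply em Γ H und))
    at-end : Σ (List (V Γ)) (Haven Γ) → QuadrantCells Γ
    at-end (X₀ , H) = [ id , (λ { (X₁ , H₁ , und) → undominated {H = H₁} und }) ]′
      (Domination.dichotomy em Γ H)

  ubiquity : G ≼ HalfGrid → (∀ n → (n · G) ≼ Γ) → ℵ₀· G ≼ Γ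
  ubiquity M Ms with dec Packing
  ... | yes packing = packing-copies packing
  ... | no none = Copies.from-quadrant em M (QuadrantCells.model (quadrant-minor none Ms))

theorem1p4 : (∀ {ℓ} → ExcludedMiddle ℓ) →
    ∀ {ℓ} (G : Graph ℓ) → Connected G → G ≼ HalfGrid → Ubiquitous G
theorem1p4 em G conn M Γ Ms = Final.ubiquity em G conn Γ M Ms
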